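{- For every real number $\nu\ge\frac{3+\sqrt5}{2}$ there are infinitely many real numbers $\alpha$ defined by modified Engel or Pierce series, i.e. arising from one of the constructions (E), (P1), (P2) described in the context, with irrationality exponent $\mu(\alpha)=\nu$.
   Context: The irrationality exponent $\mu(\alpha)$ of a real number $\alpha$ is the supremum of the set of real $\mu$ such that $0<|\alpha-P/Q|<1/Q^\mu$ holds for infinitely many rational numbers $P/Q$. Continued fractions: $[a_0;a_1,\dots,a_n]$ denotes the finite continued fraction with $a_0\in\mathbb Z$ and $a_j\in\mathbb Z_{>0}$ for $j\ge1$. The denominators $q_n$ of its convergents satisfy $q_{n+1}=a_{n+1}q_n+q_{n-1}$ for $n\ge-1$, with $q_{ -1}=0$, $q_{ -2}=1$. Every rational number has such an expansion with last index even, and one with last index odd. Common data: a rational $p/q$ in lowest terms with $q\ge1$, an integer $m\ge0$, and an arbitrary sequence $(u_n)_{n\ge1}$ of positive integers. Given a positive integer $y_0$, the sequences $(y_n)_{n\ge0}$ and $(x_n)_{n\ge1}$ are defined by $x_1=q$, $y_j=y_{j-1}(1+u_jx_j)$, $x_{j+1}=x_jy_j$ for $j\ge1$. (E) Modified Engel series: write $p/q=[a_0;a_1,\dots,a_{2k}]$ (last index even), put $y_0=mq+q_{2k-1}+1$, and let $\alpha=\frac pq+\sum_{j\ge2}\frac1{x_j}$. (P1) Modified Pierce series: assume $q>1$, write $p/q=[a_0;a_1,\dots,a_{2k}]$ (last index even), put $y_0=mq+q_{2k-1}-1$, requiring $m\ge1$ if $q_{2k-1}=1$, and let $\alpha=\frac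 pq+\sum_{j\ge2}\frac{(-1)^j}{x_j}$. (P2) Modified Pierce series: assume $q>1$, write $p/q=[a_0;a_1,\dots,a_{2k+1}]$ (last index odd), put $y_0=mq+q_{2k}-1$, requiring $m\ge1$ if $q_{2k}=1$, and let $\alpha=\frac pq-\sum_{j\ge2}\frac{(-1)^j}{x_j}$. -}

module Defs where

open import Algebra.Definitions.RawSemiring using () renaming (_^_ to pow)
open import Data.Integer.Base as ℤ using (ℤ; +_; -[1+_])
import Data.Integer.Properties as ℤ
open import Data.List.Base using (List)
open import Data.List.Relation.Unary.All using (All)
open import Data.Nat.Base as ℕ using (ℕ; zero; suc; _∸_; s≤s)
import Data.Nat.Properties as ℕ
open import Data.Nat.Solver using () renaming (module +-*-Solver to ℕ-Solver)
open import Data.Product.Base using (Σ; ∃; _×_; _,_; proj₁; proj₂)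
open import Data.Rational.Base
open import Data.Rational.Properties
open import Data.Rational.Solver using () renaming (module +-*-Solver to ℚ-Solver)
import Data.Rational.Unnormalised.Base as ℚᵘ
import Data.Rational.Unnormalised.Properties as ℚᵘ
open import Data.Sum.Base using (_⊎_; inj₁; inj₂)
open import Data.Vec.Base as Vec using (Vec; []; _∷_)
import Data.Vec.Relation.Unary.All as Vec
open import Relation.Binary.PropositionalEquality
open import Relation.Nullary using (¬_; yes; no)

------------------------------------------------------------------------
-- Rational numbers

fromℕ : ℕ → ℚ
fromℕ n = + n / 1

infixr 8 _^_ _^ᶻ_

_^_ : ℚ → ℕ → ℚ
_^_ = pow +-*-rawSemiring

-- Total reciprocal, with the convention inv 0 = 0; it is only applied to
-- positive numbers below.
inv : ℚ → ℚ
inv   (mkℚ (+ zero)  _ _) = 0ℚ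
inv p@(mkℚ (+ suc _) _ _) = 1/ p
inv p@(mkℚ -[1+ _ ]  _ _) = 1/ p

_^ᶻ_ : ℚ → ℤ → ℚ
p ^ᶻ (+ n)    = p ^ n
p ^ᶻ -[1+ n ] = inv p ^ suc n

∑< : ℕ → (ℕ → ℚ) → ℚ
∑< zero    f = 0ℚ
∑< (suc n) f = ∑< n f + f n

------------------------------------------------------------------------
-- Real numbers: Cauchy sequences of rationals, whose equality is the
-- setoid equality "neither x <ᴿ y nor y <ᴿ x"

Cauchy : (ℕ → ℚ) → Set
Cauchy s = ∀ ε → 0ℚ < ε →
           ∃ λ N → ∀ m n → N ℕ.≤ m → N ℕ.≤ n → ∣ s m - s n ∣ < ε

record ℝ : Set where
  constructor mkℝ
  field
    seq    : ℕ → ℚ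
    cauchy : Cauchy seq

open ℝ public

infix 4 _<ᴿ_ _≤ᴿ_ _#_

_<ᴿ_ : ℝ → ℝ → Set
x <ᴿ y = ∃ λ ε → 0ℚ < ε × ∃ λ N → ∀ n → N ℕ.≤ n → seq x n + ε ≤ seq y n

_≤ᴿ_ : ℝ → ℝ → Set
x ≤ᴿ y = ¬ (y <ᴿ x)

_#_ : ℝ → ℝ → Set
x # y = x <ᴿ y ⊎ y <ᴿ x

private
  ½*-pos : ∀ {ε} → 0ℚ < ε → 0ℚ < ½ * ε
  ½*-pos {ε} 0<ε = subst (_< ½ * ε) (*-zeroʳ ½) (*-monoʳ-<-pos ½ 0<ε)

  ½*+½* : ∀ ε → ½ * ε + ½ * ε ≡ ε
  ½*+½* ε = trans (sym (*-distribʳ-+ ε ½ ½)) (*-identityˡ ε)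

  ½*-≤ : ∀ {x} → 0ℚ ≤ x → ½ * x ≤ x
  ½*-≤ {x} 0≤x = begin
    ½ * x          ≡⟨ +-identityʳ (½ * x) ⟨
    ½ * x + 0ℚ     ≤⟨ +-monoʳ-≤ (½ * x) (subst (_≤ ½ * x) (*-zeroʳ ½) (*-monoˡ-≤-nonNeg ½ 0≤x)) ⟩
    ½ * x + ½ * x  ≡⟨ ½*+½* x ⟩
    x              ∎
    where open ≤-Reasoning

  ∣∣-< : ∀ {x ε} → x < ε → - x < ε → ∣ x ∣ < ε
  ∣∣-< {x} x<ε -x<ε with ∣p∣≡p∨∣p∣≡-p x
  ... | inj₁ eq = subst (_< _) (sym eq) x<ε
  ... | inj₂ eq = subst (_< _) (sym eq) -x<ε

  p≤∣p∣ : ∀ p → p ≤ ∣ p ∣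
  p≤∣p∣ p with ≤-total 0ℚ p
  ... | inj₁ 0≤p = ≤-reflexive (sym (0≤p⇒∣p∣≡p 0≤p))
  ... | inj₂ p≤0 = ≤-trans p≤0 (0≤∣p∣ p)

  swap-∣-∣ : ∀ p q → ∣ p - q ∣ ≡ ∣ q - p ∣
  swap-∣-∣ p q = trans (sym (∣-p∣≡∣p∣ (p - q))) (cong ∣_∣
    (solve 2 (λ p q → :- (p :- q) := q :- p) refl p q))
    where open ℚ-Solver

  ∣∣-reverse : ∀ p q → ∣ p ∣ - ∣ q ∣ ≤ ∣ p - q ∣
  ∣∣-reverse p q = begin
    ∣ p ∣ - ∣ q ∣                ≡⟨ cong (λ z → ∣ z ∣ - ∣ q ∣) (solve 2 (λ p q → p := (p :- q) :+ q) refl p q) ⟩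
    ∣ (p - q) + q ∣ - ∣ q ∣      ≤⟨ +-monoˡ-≤ (- ∣ q ∣) (∣p+q∣≤∣p∣+∣q∣ (p - q) q) ⟩
    (∣ p - q ∣ + ∣ q ∣) - ∣ q ∣  ≡⟨ solve 2 (λ a b → (a :+ b) :- b := a) refl ∣ p - q ∣ ∣ q ∣ ⟩
    ∣ p - q ∣                    ∎
    where open ≤-Reasoning
          open ℚ-Solver

  ∣∣-∣∣-≤ : ∀ p q {ε} → ∣ p - q ∣ < ε → ∣ ∣ p ∣ - ∣ q ∣ ∣ < ε
  ∣∣-∣∣-≤ p q {ε} h = ∣∣-<
    (≤-<-trans (∣∣-reverse p q) h)
    (subst (_< ε) (solve 2 (λ a b → b :- a := :- (a :- b)) refl ∣ p ∣ ∣ q ∣)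
      (≤-<-trans (∣∣-reverse q p) (subst (_< ε) (swap-∣-∣ p q) h)))
    where open ℚ-Solver

fromℚ : ℚ → ℝ
fromℚ p = mkℝ (λ _ → p) λ ε 0<ε → 0 , λ _ _ _ _ →
  subst (λ z → ∣ z ∣ < ε) (sym (+-inverseʳ p)) 0<ε

infixl 6 _+ᴿ_ _-ᴿ_
infix  8 -ᴿ_ ½*ᴿ_

_+ᴿ_ : ℝ → ℝ → ℝ
mkℝ s cs +ᴿ mkℝ t ct = mkℝ (λ n → s n + t n) λ ε 0<ε →
  let M , hs = cs (½ * ε) (½*-pos 0<ε)
      N , ht = ct (½ * ε) (½*-pos 0<ε)
  in M ℕ.⊔ N , λ m n le le′ → begin-strict
    ∣ (s m + t m) - (s n + t n) ∣    ≡⟨ cong ∣_∣ (solve 4 (λ a b c d → (a :+ b) :- (c :+ d) := (a :- c) :+ (b :- d)) refl (s m) (t m) (s n) (t n)) ⟩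
    ∣ (s m - s n) + (t m - t n) ∣    ≤⟨ ∣p+q∣≤∣p∣+∣q∣ (s m - s n) (t m - t n) ⟩
    ∣ s m - s n ∣ + ∣ t m - t n ∣    <⟨ +-mono-< (hs m n (ℕ.m⊔n≤o⇒m≤o M N le) (ℕ.m⊔n≤o⇒m≤o M N le′))
                                               (ht m n (ℕ.m⊔n≤o⇒n≤o M N le) (ℕ.m⊔n≤o⇒n≤o M N le′)) ⟩
    ½ * ε + ½ * ε                    ≡⟨ ½*+½* ε ⟩
    ε                                ∎
  where open ≤-Reasoning
        open ℚ-Solver

-ᴿ_ : ℝ → ℝ
-ᴿ mkℝ s cs = mkℝ (λ n → - s n) λ ε 0<ε →
  let N , h = cs ε 0<ε
  in N , λ m n le le′ → subst (_< ε)
       (trans (swap-∣-∣ (s m) (s n)) (cong ∣_∣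
         (solve 2 (λ a b → b :- a := (:- a) :- (:- b)) refl (s m) (s n))))
       (h m n le le′)
  where open ℚ-Solver

_-ᴿ_ : ℝ → ℝ → ℝ
x -ᴿ y = x +ᴿ (-ᴿ y)

∣_∣ᴿ : ℝ → ℝ
∣ mkℝ s cs ∣ᴿ = mkℝ (λ n → ∣ s n ∣) λ ε 0<ε →
  let N , h = cs ε 0<ε
  in N , λ m n le le′ → ∣∣-∣∣-≤ (s m) (s n) (h m n le le′)

½*ᴿ_ : ℝ → ℝ
½*ᴿ mkℝ s cs = mkℝ (λ n → ½ * s n) λ ε 0<ε →
  let N , h = cs ε 0<ε
  in N , λ m n le le′ → begin-strict
    ∣ ½ * s m - ½ * s n ∣  ≡⟨ cong ∣_∣ (solve 3 (λ c a b → c :* a :- c :* b := c :* (a :- b)) refl ½ (s m) (s n)) ⟩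
    ∣ ½ * (s m - s n) ∣    ≡⟨ ∣p*q∣≡∣p∣*∣q∣ ½ (s m - s n) ⟩
    ½ * ∣ s m - s n ∣      ≤⟨ ½*-≤ (0≤∣p∣ (s m - s n)) ⟩
    ∣ s m - s n ∣          <⟨ h m n le le′ ⟩
    ε                      ∎
  where open ≤-Reasoning
        open ℚ-Solver

infix 4 _⟶_

_⟶_ : (ℕ → ℚ) → ℝ → Set
s ⟶ x = ∀ ε → 0ℚ < ε →
        ∃ λ N → ∀ n → N ℕ.≤ n → ∣ fromℚ (s n) -ᴿ x ∣ᴿ <ᴿ fromℚ ε

------------------------------------------------------------------------
-- Square roots of natural numbers

⌊√_⌋ : ℕ → ℕ
⌊√ zero ⌋ = 0
⌊√ suc n ⌋ with suc ⌊√ n ⌋ ℕ.* suc ⌊√ n ⌋ ℕ.≤? suc n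
... | yes _ = suc ⌊√ n ⌋
... | no  _ = ⌊√ n ⌋

⌊√⌋-lower : ∀ n → ⌊√ n ⌋ ℕ.* ⌊√ n ⌋ ℕ.≤ n
⌊√⌋-lower zero = ℕ.z≤n
⌊√⌋-lower (suc n) with suc ⌊√ n ⌋ ℕ.* suc ⌊√ n ⌋ ℕ.≤? suc n
... | yes le = le
... | no  _  = ℕ.m≤n⇒m≤1+n (⌊√⌋-lower n)

⌊√⌋-upper : ∀ n → n ℕ.< suc ⌊√ n ⌋ ℕ.* suc ⌊√ n ⌋
⌊√⌋-upper zero = s≤s ℕ.z≤n
⌊√⌋-upper (suc n) with suc ⌊√ n ⌋ ℕ.* suc ⌊√ n ⌋ ℕ.≤? suc n
... | yes _ = ℕ.≤-<-trans (⌊√⌋-upper n) (ℕ.*-mono-< (lt ⌊√ n ⌋) (lt ⌊√ n ⌋))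
  where
  lt : ∀ k → suc k ℕ.< suc (suc k)
  lt k = ℕ.n<1+n (suc k)
... | no ¬le = ℕ.≰⇒> ¬le

√-seq : ℕ → ℕ → ℚ
√-seq c n = + ⌊√ c ℕ.* (suc n ℕ.* suc n) ⌋ / suc n

private
  square-cancel-< : ∀ {a b} → a ℕ.* a ℕ.< b ℕ.* b → a ℕ.< b
  square-cancel-< {a} {b} lt with a ℕ.<? b
  ... | yes a<b = a<b
  ... | no  a≮b with () ← ℕ.<-irrefl refl
    (ℕ.<-≤-trans lt (ℕ.*-mono-≤ (ℕ.≮⇒≥ a≮b) (ℕ.≮⇒≥ a≮b)))

  √-cross : ∀ c m n →
    ⌊√ c ℕ.* (suc m ℕ.* suc m) ⌋ ℕ.* suc n ℕ.<
    suc ⌊√ c ℕ.* (suc n ℕ.* suc n) ⌋ ℕ.* suc m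
  √-cross c m n = square-cancel-< (begin-strict
    (a ℕ.* N) ℕ.* (a ℕ.* N)          ≡⟨ interchange a N ⟩
    (a ℕ.* a) ℕ.* (N ℕ.* N)          ≤⟨ ℕ.*-monoˡ-≤ (N ℕ.* N) (⌊√⌋-lower (c ℕ.* (M ℕ.* M))) ⟩
    (c ℕ.* (M ℕ.* M)) ℕ.* (N ℕ.* N)  ≡⟨ solve 3 (λ c x y → (c :* x) :* y := (c :* y) :* x) refl c (M ℕ.* M) (N ℕ.* N) ⟩
    (c ℕ.* (N ℕ.* N)) ℕ.* (M ℕ.* M)  <⟨ ℕ.*-monoˡ-< (M ℕ.* M) (⌊√⌋-upper (c ℕ.* (N ℕ.* N))) ⟩
    (b ℕ.* b) ℕ.* (M ℕ.* M)          ≡⟨ interchange b M ⟨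
    (b ℕ.* M) ℕ.* (b ℕ.* M)          ∎)
    where
    open ℕ.≤-Reasoning
    open ℕ-Solver
    M = suc m
    N = suc n
    a = ⌊√ c ℕ.* (M ℕ.* M) ⌋
    b = suc ⌊√ c ℕ.* (N ℕ.* N) ⌋
    interchange : ∀ x y → (x ℕ.* y) ℕ.* (x ℕ.* y) ≡ (x ℕ.* x) ℕ.* (y ℕ.* y)
    interchange = solve 2 (λ x y → (x :* y) :* (x :* y) := (x :* x) :* (y :* y)) refl

  /-<ᵘ : ∀ a b m n → a ℕ.* suc n ℕ.< b ℕ.* suc m →
         ℚᵘ.mkℚᵘ (+ a) m ℚᵘ.< ℚᵘ.mkℚᵘ (+ b) n
  /-<ᵘ a b m n lt = ℚᵘ.*<*
    (subst₂ ℤ._<_ (ℤ.pos-* a (suc n)) (ℤ.pos-* b (suc m)) (ℤ.+<+ lt))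

  /-< : ∀ a b m n → a ℕ.* suc n ℕ.< b ℕ.* suc m → + a / suc m < + b / suc n
  /-< a b m n lt = toℚᵘ-cancel-< (begin-strict
    toℚᵘ (+ a / suc m)   ≃⟨ toℚᵘ-fromℚᵘ (ℚᵘ.mkℚᵘ (+ a) m) ⟩
    ℚᵘ.mkℚᵘ (+ a) m      <⟨ /-<ᵘ a b m n lt ⟩
    ℚᵘ.mkℚᵘ (+ b) n      ≃⟨ toℚᵘ-fromℚᵘ (ℚᵘ.mkℚᵘ (+ b) n) ⟨
    toℚᵘ (+ b / suc n)   ∎)
    where open ℚᵘ.≤-Reasoning

  suc-/ : ∀ b n → + suc b / suc n ≡ + b / suc n + + 1 / suc n
  suc-/ b n = toℚᵘ-injective (begin
    toℚᵘ (+ suc b / suc n)                     ≈⟨ toℚᵘ-fromℚᵘ (ℚᵘ.mkℚᵘ (+ suc b) n) ⟩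
    ℚᵘ.mkℚᵘ (+ suc b) n                        ≈⟨ ℚᵘ.*≡* eq ⟩
    ℚᵘ.mkℚᵘ (+ b) n ℚᵘ.+ ℚᵘ.mkℚᵘ (+ 1) n       ≈⟨ ℚᵘ.+-cong (toℚᵘ-fromℚᵘ (ℚᵘ.mkℚᵘ (+ b) n)) (toℚᵘ-fromℚᵘ (ℚᵘ.mkℚᵘ (+ 1) n)) ⟨
    toℚᵘ (+ b / suc n) ℚᵘ.+ toℚᵘ (+ 1 / suc n) ≈⟨ toℚᵘ-homo-+ (+ b / suc n) (+ 1 / suc n) ⟨
    toℚᵘ (+ b / suc n + + 1 / suc n)           ∎)
    where
    open import Relation.Binary.Reasoning.Setoid ℚᵘ.≃-setoid
    N = suc n
    eq : + suc b ℤ.* + (N ℕ.* N) ≡ (+ b ℤ.* + N ℤ.+ + 1 ℤ.* + N) ℤ.* + N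
    eq = trans (cong (+ suc b ℤ.*_) (ℤ.pos-* N N))
      (trans (sym (ℤ.*-assoc (+ suc b) (+ N) (+ N)))
        (cong (ℤ._* + N) (trans
          (cong (ℤ._* + N) (ℤ.+-comm (+ 1) (+ b)))
          (ℤ.*-distribʳ-+ (+ N) (+ b) (+ 1)))))

  archimedean : ∀ ε → 0ℚ < ε → ∃ λ N → ∀ n → N ℕ.≤ n → + 1 / suc n < ε
  archimedean ε@(mkℚ (+ zero)  d _) 0<ε with () ← <-irrefl (sym (↥p≡0⇒p≡0 ε refl)) 0<ε
  archimedean (mkℚ -[1+ _ ] _ _) (*<* ())
  archimedean ε@(mkℚ (+ suc a) d _) _ = suc d , λ n d<n →
    toℚᵘ-cancel-< (ℚᵘ.<-respˡ-≃ (ℚᵘ.≃-sym (toℚᵘ-fromℚᵘ (ℚᵘ.mkℚᵘ (+ 1) n)))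
      (/-<ᵘ 1 (suc a) n d (begin-strict
        1 ℕ.* suc d      ≡⟨ ℕ.*-identityˡ (suc d) ⟩
        suc d            ≤⟨ d<n ⟩
        n                <⟨ ℕ.n<1+n n ⟩
        suc n            ≤⟨ ℕ.m≤m+n (suc n) (a ℕ.* suc n) ⟩
        suc a ℕ.* suc n  ∎)))
    where open ℕ.≤-Reasoning

  √-seq-< : ∀ c m n → √-seq c m - √-seq c n < + 1 / suc n
  √-seq-< c m n = begin-strict
    √-seq c m - √-seq c n          <⟨ +-monoˡ-< (- √-seq c n) (/-< a (suc b) m n (√-cross c m n)) ⟩
    + suc b / suc n - √-seq c n    ≡⟨ cong (_- √-seq c n) (suc-/ b n) ⟩
    √-seq c n + e - √-seq c n      ≡⟨ solve 2 (λ x y → (x :+ y) :- x := y) refl (√-seq c n) e ⟩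
    e                              ∎
    where
    open ≤-Reasoning
    open ℚ-Solver
    a = ⌊√ c ℕ.* (suc m ℕ.* suc m) ⌋
    b = ⌊√ c ℕ.* (suc n ℕ.* suc n) ⌋
    e = + 1 / suc n

√ : ℕ → ℝ
√ c = mkℝ (√-seq c) λ ε 0<ε →
  let N , h = archimedean ε 0<ε
  in N , λ m n N≤m N≤n → ∣∣-<
       (<-trans (√-seq-< c m n) (h n N≤n))
       (subst (_< ε) (solve 2 (λ a b → b :- a := :- (a :- b)) refl (√-seq c m) (√-seq c n))
         (<-trans (√-seq-< c n m) (h m N≤m)))
  where open ℚ-Solver

⟨3+√5⟩/2 : ℝ
⟨3+√5⟩/2 = ½*ᴿ (fromℚ (fromℕ 3) +ᴿ √ 5)

------------------------------------------------------------------------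
-- The irrationality exponent

InfinitelyMany : {A : Set} (_≉_ : A → A → Set) → (A → Set) → Set
InfinitelyMany _≉_ P = ∀ xs → ∃ λ x → P x × All (x ≉_) xs

-- The positive part of the lower cut of the real number 1/Q^μ (Q ≥ 1), which
-- is the supremum of the 1/Q^r over rational r > μ.  With r = a/b and t > 0,
-- t < 1/Q^r means t^b Q^a < 1.
1/⟨_^_⟩ : ℕ → ℝ → ℚ → Set
1/⟨ Q ^ μ ⟩ t = 0ℚ < t ×
  ∃ λ r → μ <ᴿ fromℚ r × t ^ ↧ₙ r * fromℕ Q ^ᶻ ↥ r < 1ℚ

infix 4 _≺_

_≺_ : ℝ → (ℚ → Set) → Set
x ≺ cut = ∃ λ t → cut t × x <ᴿ fromℚ t

Approximable : ℝ → ℝ → Set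
Approximable α μ = InfinitelyMany _≢_ λ (P/Q : ℚ) →
  let δ = ∣ α -ᴿ fromℚ P/Q ∣ᴿ in
  fromℚ 0ℚ <ᴿ δ × δ ≺ 1/⟨ ↧ₙ P/Q ^ μ ⟩

IsSupremum : (ℝ → Set) → ℝ → Set
IsSupremum S ν =
  (∀ μ → S μ → μ ≤ᴿ ν) × (∀ l → l <ᴿ ν → ∃ λ μ → S μ × l <ᴿ μ)

IrrationalityExponent : ℝ → ℝ → Set
IrrationalityExponent α ν = IsSupremum (Approximable α) ν

------------------------------------------------------------------------
-- Continued fractions

[_⨾_] : ∀ {n} → ℤ → Vec ℕ n → ℚ
[ a₀ ⨾ []     ] = a₀ / 1
[ a₀ ⨾ a ∷ as ] = a₀ / 1 + inv [ + a ⨾ as ]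

-- (q_{n-1} , q_n) for [a₀; a₁, …, a_n].  The recurrence is started at
-- (q_{-1} , q_0) = (0 , 1), since q_0 = a₀ q_{-1} + q_{-2} = 1 for every a₀.
denominators : ∀ {n} → Vec ℕ n → ℕ × ℕ
denominators = Vec.foldl (λ _ → ℕ × ℕ)
  (λ (q₋ , q) a → q , a ℕ.* q ℕ.+ q₋) (0 , 1)

------------------------------------------------------------------------
-- Modified Engel and Pierce series

-- Index shift, as the sequences u and x start at index 1:
-- xy q y₀ u j = (x_{j+1} , y_j), and u j stands for u_{j+1}.
xy : (q y₀ : ℕ) (u : ℕ → ℕ) → ℕ → ℕ × ℕ
xy q y₀ u zero    = q , y₀
xy q y₀ u (suc j) =
  let x , y = xy q y₀ u j
      y′    = y ℕ.* (1 ℕ.+ u j ℕ.* x)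
  in x ℕ.* y′ , y′

record Data (n : ℕ) : Set where
  field
    p/q       : ℚ
    a₀        : ℤ
    a         : Vec ℕ n
    a-pos     : Vec.All (0 ℕ.<_) a
    expansion : p/q ≡ [ a₀ ⨾ a ]
    m         : ℕ
    u         : ℕ → ℕ
    u-pos     : ∀ j → 0 ℕ.< u j

  q : ℕ
  q = ↧ₙ p/q

  -- q_{n-1}
  q₋ : ℕ
  q₋ = proj₁ (denominators a)

  -- x_{i+2}, the term of index i of a series over j ≥ 2
  x₂₊ : (y₀ : ℕ) → ℕ → ℕ
  x₂₊ y₀ i = proj₁ (xy q y₀ u (suc i))

ModifiedEngel : ℝ → Set
ModifiedEngel α = ∃ λ k → Σ (Data (2 ℕ.* k)) λ D → let open Data D in
  let y₀ = m ℕ.* q ℕ.+ q₋ ℕ.+ 1 in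
  (λ N → p/q + ∑< N λ i → inv (fromℕ (x₂₊ y₀ i))) ⟶ α

ModifiedPierce₁ : ℝ → Set
ModifiedPierce₁ α = ∃ λ k → Σ (Data (2 ℕ.* k)) λ D → let open Data D in
  let y₀ = m ℕ.* q ℕ.+ q₋ ∸ 1 in
  1 ℕ.< q × (q₋ ≡ 1 → 1 ℕ.≤ m) ×
  (λ N → p/q + ∑< N λ i → (- 1ℚ) ^ (2 ℕ.+ i) * inv (fromℕ (x₂₊ y₀ i))) ⟶ α

ModifiedPierce₂ : ℝ → Set
ModifiedPierce₂ α = ∃ λ k → Σ (Data (2 ℕ.* k ℕ.+ 1)) λ D → let open Data D in
  let y₀ = m ℕ.* q ℕ.+ q₋ ∸ 1 in
  1 ℕ.< q × (q₋ ≡ 1 → 1 ℕ.≤ m) ×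
  (λ N → p/q - ∑< N λ i → (- 1ℚ) ^ (2 ℕ.+ i) * inv (fromℕ (x₂₊ y₀ i))) ⟶ α

ModifiedEngelOrPierce : ℝ → Set
ModifiedEngelOrPierce α =
  ModifiedEngel α ⊎ ModifiedPierce₁ α ⊎ ModifiedPierce₂ α

-- In the Engel construction take for p/q an integer i (so q = 1, k = 0) and
-- m = 0; then x₁ = y₀ = 1, and i serves only to move α past the given reals.
-- Below X j is x_{j+1}, Y j is y_j and S j is the j-th partial sum.
--
-- Since Y j divides Y (j + 1), the denominator of S j is exactly X j, while
-- α − S j lies between 1/X (j + 1) and 2/X (j + 1).  Hence μ(α) ≥ ν as soon
-- as log X (j + 1) / log X j → ν.  The u's are chosen greedily, as large as
-- possible subject to X (j + 1) ^ j ≤ X j ^ a j with j ν + 2 < a j ≤ j ν + 4.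
-- Even u = 1 makes X (j + 1) about X j ^ (3 − 1/ν), so such a choice exists
-- because ν + 1/ν ≥ 3, which is the hypothesis on ν; the excess of a j / j
-- over ν decreases slowly enough to survive the passage from j to j + 1.
--
-- Conversely, let Y j ≤ 4 Q < Y (j + 1).  A fraction P/Q other than S j
-- differs from S j by at least 1/(Q X j), hence from α by at least half of
-- that, and X j is about Y j ^ (ν / (ν − 1)), where ν / (ν − 1) ≤ ν − 1 again
-- by the hypothesis on ν.  So no fraction improves on the exponent ν.
module Submission where

open import Data.Product.Base using (∃; _×_; _,_; proj₁; proj₂)
open import Relation.Binary.PropositionalEquality hiding (J)
open import Relation.Nullary using (¬_; Dec; yes; no; contradiction)

-- Natural numbers

module Powers where

  open import Data.Nat.Base
  open import Data.Nat.Properties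
  open import Data.Nat.Tactic.RingSolver using (solve-∀)
  open import Relation.Unary using (Decidable)

  ^-distribʳ-* : ∀ x y n → (x * y) ^ n ≡ x ^ n * y ^ n
  ^-distribʳ-* x y zero    = refl
  ^-distribʳ-* x y (suc n) = trans (cong (x * y *_) (^-distribʳ-* x y n)) (swap x y (x ^ n) (y ^ n))
    where
    swap : ∀ x y p q → x * y * (p * q) ≡ x * p * (y * q)
    swap = solve-∀

  ^-cancelˡ-≤ : ∀ n .{{_ : NonZero n}} {x y} → x ^ n ≤ y ^ n → x ≤ y
  ^-cancelˡ-≤ n {x} {y} le = ≮⇒≥ λ y<x → <⇒≱ (^-monoˡ-< n y<x) le

  ^-swap : ∀ x m n → (x ^ m) ^ n ≡ (x ^ n) ^ m
  ^-swap x m n = trans (^-*-assoc x m n) (trans (cong (x ^_) (*-comm m n)) (sym (^-*-assoc x n m)))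

  -- Greedy search with bounded fuel.

  climb : {P : ℕ → Set} → Decidable P → ℕ → ℕ → ℕ
  climb P? zero    u = u
  climb P? (suc n) u with P? (suc u)
  ... | yes _ = climb P? n (suc u)
  ... | no  _ = u

  module _ {P : ℕ → Set} (P? : Decidable P) where

    climb-≥ : ∀ n u → u ≤ climb P? n u
    climb-≥ zero    u = ≤-refl
    climb-≥ (suc n) u with P? (suc u)
    ... | yes _ = ≤-trans (n≤1+n u) (climb-≥ n (suc u))
    ... | no  _ = ≤-refl

    climb-holds : ∀ n u → P u → P (climb P? n u)
    climb-holds zero    u p = p
    climb-holds (suc n) u p with P? (suc u)
    ... | yes q = climb-holds n (suc u) q
    ... | no  _ = p

    -- A search that stops early stops because the next number fails `P`. A search that spends all
    -- its fuel ends at `n + u`, and there the hypothesis applies.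
    climb-maximal : ∀ n u → ¬ P (suc (n + u)) → ¬ P (suc (climb P? n u))
    climb-maximal zero    u ¬p = ¬p
    climb-maximal (suc n) u ¬p with P? (suc u)
    ... | yes _ = climb-maximal n (suc u) (subst (λ k → ¬ P (suc k)) (sym (+-suc n u)) ¬p)
    ... | no ¬q = ¬q

  -- With R = a/b and R′ = a′/b′, the last hypothesis says R′ + 1/R > 3.  Here
  -- x ≤ w ^ R bounds y by x ^ (1 - 1/R), hence the left-hand side by about
  -- x ^ (3 - 1/R) before taking powers.
  minimal-step : ∀ {a a′ b b′ w x y} .{{_ : NonZero a}} →
    x ≡ w * y → x ^ b ≤ w ^ a → 2 ^ (a * b′) ≤ x →
    3 * a * b′ + 1 ≤ a * a′ + b * b′ →
    (x * (y * (1 + 1 * x))) ^ b′ ≤ x ^ a′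
  minimal-step {a} {a′} {b} {b′} {w} {x} {y} x≡wy A big slack =
    -- Raising to the power `a` and multiplying by `x ^ (b * b′)` makes the product `x ^ b * y ^ a`
    -- appear, and this product is what `A` bounds, by `x ^ a`.
    ^-cancelˡ-≤ a (*-cancelʳ-≤ _ _ (x ^ (b * b′)) {{m^n≢0 x (b * b′)}} (begin
      ((x * (y * (1 + 1 * x))) ^ b′) ^ a * x ^ (b * b′)
        ≤⟨ *-monoˡ-≤ (x ^ (b * b′)) (^-monoˡ-≤ a (^-monoˡ-≤ b′ le₁)) ⟩
      ((2 * (y * (x * x))) ^ b′) ^ a * x ^ (b * b′)
        ≡⟨ cong₂ _*_ (^-swap (2 * (y * (x * x))) b′ a) (sym (^-*-assoc x b b′)) ⟩
      ((2 * (y * (x * x))) ^ a) ^ b′ * (x ^ b) ^ b′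
        ≡⟨ ^-distribʳ-* ((2 * (y * (x * x))) ^ a) (x ^ b) b′ ⟨
      ((2 * (y * (x * x))) ^ a * x ^ b) ^ b′
        ≡⟨ cong (_^ b′) (trans (cong (_* x ^ b) (expand a)) (regroup (2 ^ a) (y ^ a) (x ^ a) (x ^ b))) ⟩
      (2 ^ a * (x ^ a * x ^ a) * (x ^ b * y ^ a)) ^ b′
        ≤⟨ ^-monoˡ-≤ b′ (*-monoʳ-≤ (2 ^ a * (x ^ a * x ^ a)) le₂) ⟩
      (2 ^ a * (x ^ a * x ^ a) * x ^ a) ^ b′
        ≡⟨ cong (_^ b′) (trans (*-assoc (2 ^ a) (x ^ a * x ^ a) (x ^ a)) (cong (2 ^ a *_) cube)) ⟩
      (2 ^ a * x ^ (3 * a)) ^ b′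
        ≡⟨ trans (^-distribʳ-* (2 ^ a) (x ^ (3 * a)) b′) (cong₂ _*_ (^-*-assoc 2 a b′) (^-*-assoc x (3 * a) b′)) ⟩
      2 ^ (a * b′) * x ^ (3 * a * b′)
        ≤⟨ *-monoˡ-≤ (x ^ (3 * a * b′)) big ⟩
      x * x ^ (3 * a * b′)
        ≡⟨ cong (x ^_) (+-comm 1 (3 * a * b′)) ⟩
      x ^ (3 * a * b′ + 1)
        ≤⟨ ^-monoʳ-≤ x slack ⟩
      x ^ (a * a′ + b * b′)
        ≡⟨ ^-distribˡ-+-* x (a * a′) (b * b′) ⟩
      x ^ (a * a′) * x ^ (b * b′)
        ≡⟨ cong (_* x ^ (b * b′)) (trans (cong (x ^_) (*-comm a a′)) (sym (^-*-assoc x a′ a))) ⟩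
      (x ^ a′) ^ a * x ^ (b * b′)  ∎))
    where
    open ≤-Reasoning
    1≤x : 1 ≤ x
    1≤x = ≤-trans (m^n>0 2 (a * b′)) big
    instance
      x≢0 : NonZero x
      x≢0 = >-nonZero 1≤x
    le₁ : x * (y * (1 + 1 * x)) ≤ 2 * (y * (x * x))
    le₁ = begin
      x * (y * (1 + 1 * x))  ≤⟨ *-monoʳ-≤ x (*-monoʳ-≤ y (+-monoˡ-≤ (1 * x) 1≤x)) ⟩
      x * (y * (x + 1 * x))  ≡⟨ eq x y ⟩
      2 * (y * (x * x))      ∎
      where
      eq : ∀ x y → x * (y * (x + 1 * x)) ≡ 2 * (y * (x * x))
      eq = solve-∀
    le₂ : x ^ b * y ^ a ≤ x ^ a
    le₂ = begin
      x ^ b * y ^ a  ≤⟨ *-monoˡ-≤ (y ^ a) A ⟩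
      w ^ a * y ^ a  ≡⟨ ^-distribʳ-* w y a ⟨
      (w * y) ^ a    ≡⟨ cong (_^ a) x≡wy ⟨
      x ^ a          ∎
    expand : ∀ a → (2 * (y * (x * x))) ^ a ≡ 2 ^ a * (y ^ a * (x ^ a * x ^ a))
    expand a = trans (^-distribʳ-* 2 (y * (x * x)) a) (cong (2 ^ a *_)
      (trans (^-distribʳ-* y (x * x) a) (cong (y ^ a *_) (^-distribʳ-* x x a))))
    regroup : ∀ t y x z → t * (y * (x * x)) * z ≡ t * (x * x) * (z * y)
    regroup = solve-∀
    cube : x ^ a * x ^ a * x ^ a ≡ x ^ (3 * a)
    cube = trans (eq (x ^ a)) (trans (^-*-assoc x a 3) (cong (x ^_) (*-comm a 3)))
      where
      eq : ∀ t → t * t * t ≡ t * (t * (t * 1))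
      eq = solve-∀

  -- With C = A ∸ B, the inequality B * A ≤ C * C says A/B ≥ (3 + √5)/2.
  golden-power : ∀ {A B C x w y} .{{_ : NonZero A}} .{{_ : NonZero x}} → A ≡ B + C → B * A ≤ C * C →
    x ≡ w * y → w ^ A ≤ x ^ B → x ^ B ≤ y ^ C
  golden-power {A} {B} {C} {x} {w} {y} A≡B+C BA≤CC x≡wy h = ^-cancelˡ-≤ A (begin
    (x ^ B) ^ A  ≡⟨ ^-*-assoc x B A ⟩
    x ^ (B * A)  ≤⟨ ^-monoʳ-≤ x BA≤CC ⟩
    x ^ (C * C)  ≡⟨ ^-*-assoc x C C ⟨
    (x ^ C) ^ C  ≤⟨ ^-monoˡ-≤ C xC≤yA ⟩
    (y ^ A) ^ C  ≡⟨ ^-swap y A C ⟩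
    (y ^ C) ^ A  ∎)
    where
    open ≤-Reasoning
    -- As `x` is `w * y`, the bound on `w` from above becomes one on `y` from below: y ≥ x^(C/A).
    xC≤yA : x ^ C ≤ y ^ A
    xC≤yA = *-cancelˡ-≤ (x ^ B) {{m^n≢0 x B}} (begin
      x ^ B * x ^ C  ≡⟨ ^-distribˡ-+-* x B C ⟨
      x ^ (B + C)    ≡⟨ cong (x ^_) A≡B+C ⟨
      x ^ A          ≡⟨ cong (_^ A) x≡wy ⟩
      (w * y) ^ A    ≡⟨ ^-distribʳ-* w y A ⟩
      w ^ A * y ^ A  ≤⟨ *-monoˡ-≤ (y ^ A) h ⟩
      x ^ B * y ^ A  ∎)

  -- After cancelling `x`, the hypothesis says x′ ≥ x^((e+1)/j), while x^(c/b) ≤ x^(e/j). The one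
  -- spare factor `x` is at least `4 ^ (b * j)`; this pays for the constant 3 with strictness to
  -- spare.
  good-approximation : ∀ {x x′ e j b c} .{{_ : NonZero x}} .{{_ : NonZero j}} .{{_ : NonZero b}} →
    x ^ (2 + e) ≤ x * x′ ^ j → c * j ≤ e * b → 4 ^ (b * j) ≤ x →
    3 ^ b * x ^ c < x′ ^ b
  good-approximation {x} {x′} {e} {j} {b} {c} h cj≤eb big = <-≤-trans
    (*-monoˡ-< (x ^ c) {{m^n≢0 x c}} (^-monoˡ-< b (n<1+n 3)))
    (^-cancelˡ-≤ j (begin
      (4 ^ b * x ^ c) ^ j          ≡⟨ trans (^-distribʳ-* (4 ^ b) (x ^ c) j) (cong₂ _*_ (^-*-assoc 4 b j) (^-*-assoc x c j)) ⟩
      4 ^ (b * j) * x ^ (c * j)    ≤⟨ *-mono-≤ (≤-trans big (x≤x^b b)) (^-monoʳ-≤ x cj≤eb) ⟩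
      x ^ b * x ^ (e * b)          ≡⟨ ^-distribˡ-+-* x b (e * b) ⟨
      x ^ (suc e * b)              ≡⟨ ^-*-assoc x (suc e) b ⟨
      (x ^ suc e) ^ b              ≤⟨ ^-monoˡ-≤ b (*-cancelˡ-≤ x h) ⟩
      (x′ ^ j) ^ b                 ≡⟨ ^-swap x′ j b ⟩
      (x′ ^ b) ^ j                 ∎))
    where
    open ≤-Reasoning
    x≤x^b : ∀ b .{{_ : NonZero b}} → x ≤ x ^ b
    x≤x^b (suc b) = subst (_≤ x * x ^ b) (*-identityʳ x) (*-monoʳ-≤ x (m^n>0 x b))

  -- Both `2 * q` and `y` are at most `4 * q`, so the left-hand side is at most `(4 * q) ^ (k + C)`.
  -- Its constant `4 ^ A` is at most `q`, hence the one extra factor `q` in the conclusion.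
  bad-approximation : ∀ {A k C x y q} → A ≡ k + C → x ^ k ≤ y ^ C → y ≤ 4 * q → 4 ^ suc A ≤ y →
    (2 * q * x) ^ k ≤ q ^ suc A
  bad-approximation {A} {k} {C} {x} {y} {q} A≡k+C h y≤4q big = begin
    (2 * q * x) ^ k              ≡⟨ ^-distribʳ-* (2 * q) x k ⟩
    (2 * q) ^ k * x ^ k          ≤⟨ *-mono-≤ (^-monoˡ-≤ k (*-monoˡ-≤ q (m≤m+n 2 2))) (≤-trans h (^-monoˡ-≤ C y≤4q)) ⟩
    (4 * q) ^ k * (4 * q) ^ C    ≡⟨ ^-distribˡ-+-* (4 * q) k C ⟨
    (4 * q) ^ (k + C)            ≡⟨ cong ((4 * q) ^_) A≡k+C ⟨
    (4 * q) ^ A                  ≡⟨ ^-distribʳ-* 4 q A ⟩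
    4 ^ A * q ^ A                ≤⟨ *-monoˡ-≤ (q ^ A) (*-cancelˡ-≤ {4 ^ A} {q} 4 (≤-trans big y≤4q)) ⟩
    q * q ^ A                    ∎
    where open ≤-Reasoning

  bracket : ∀ (g : ℕ → ℕ) q m J → g J ≤ q → q < g (m + J) → ∃ λ k → J ≤ k × g k ≤ q × q < g (suc k)
  bracket g q zero    J lo hi = contradiction hi (≤⇒≯ lo)
  bracket g q (suc m) J lo hi with q <? g (suc J)
  ... | yes q<g = J , ≤-refl , lo , q<g
  ... | no  q≮g =
    let k , J<k , rest = bracket g q m (suc J) (≮⇒≥ q≮g) (subst (λ n → q < g n) (sym (+-suc m J)) hi)
    in k , ≤-trans (n≤1+n J) J<k , rest

  -- The exponent of step j is a j / j, which for j = 0 is to be read as ∞: the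
  -- first multiplier is only required to be large.
  module Construction
    (a : ℕ → ℕ) (M : ℕ)
    (0<a : ∀ j → 0 < a j)
    (0<M : 0 < M)
    (a≤ : ∀ j → a j ≤ M * suc j)
    (slack : ∀ j → 3 * a j * suc j + 1 ≤ a j * a (suc j) + j * suc j)
    where

    open ≤-Reasoning

    Admissible : ℕ → ℕ → ℕ → ℕ → Set
    Admissible j x y u = (x * (y * (1 + u * x))) ^ j ≤ x ^ a j

    admissible? : ∀ j x y → Decidable (Admissible j x y)
    admissible? j x y u = (x * (y * (1 + u * x))) ^ j ≤? x ^ a j

    multiplier : ℕ → ℕ → ℕ → ℕ
    -- The 6 is (0 + 2)(0 + 3), as the base case of `X-growth` demands.
    multiplier zero    _ _ = 2 ^ (M * 6)
    -- An admissible `u` is smaller than `x ^ a (suc j)` for positive `x` and `y`, so this much fuel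
    -- cannot run out prematurely. The search starts at 1, which is admissible by `minimal-step`.
    multiplier (suc j) x y = climb (admissible? (suc j) x y) (x ^ a (suc j)) 1

    state : ℕ → ℕ × ℕ
    state zero    = 1 , 1
    state (suc j) =
      let x , y = state j
          y′    = y * (1 + multiplier j x y * x)
      in x * y′ , y′

    X Y u : ℕ → ℕ
    X j = proj₁ (state j)
    Y j = proj₂ (state j)
    u j = multiplier j (X j) (Y j)

    0<u : ∀ j → 0 < u j
    0<u zero    = m^n>0 2 (M * 6)
    0<u (suc j) = climb-≥ (admissible? (suc j) (X (suc j)) (Y (suc j))) (X (suc j) ^ a (suc j)) 1

    0<Y : ∀ j → 0 < Y j
    0<Y zero    = s≤s z≤n
    0<Y (suc j) = *-mono-≤ (0<Y j) (m≤m+n 1 (u j * X j))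

    0<X : ∀ j → 0 < X j
    0<X zero    = s≤s z≤n
    0<X (suc j) = *-mono-≤ (0<X j) (0<Y (suc j))

    X≢0 : ∀ j → NonZero (X j)
    X≢0 j = >-nonZero (0<X j)

    X<Y : ∀ j → X j < Y (suc j)
    X<Y j = begin
      suc (X j)                 ≡⟨ cong suc (*-identityˡ (X j)) ⟨
      1 + 1 * X j               ≤⟨ +-monoʳ-≤ 1 (*-monoˡ-≤ (X j) (0<u j)) ⟩
      1 + u j * X j             ≡⟨ *-identityˡ (1 + u j * X j) ⟨
      1 * (1 + u j * X j)       ≤⟨ *-monoˡ-≤ (1 + u j * X j) (0<Y j) ⟩
      Y j * (1 + u j * X j)     ∎

    -- The reserve from which all constants are paid; it covers for instance `2 ^ (a j * suc j)`,
    -- since `a j` is at most `M * suc j`. The induction works because each term is at least the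
    -- square of the previous one, while the quadratic (j + 2)(j + 3) at most doubles from one step
    -- to the next.
    X-growth : ∀ j → 2 ^ (M * ((j + 2) * (j + 3))) ≤ X (suc j)
    X-growth zero = begin
      2 ^ (M * 6)                      ≡⟨ *-identityʳ (2 ^ (M * 6)) ⟨
      2 ^ (M * 6) * 1                  ≤⟨ n≤1+n _ ⟩
      1 + 2 ^ (M * 6) * 1              ≡⟨ eq (2 ^ (M * 6)) ⟩
      1 * (1 * (1 + 2 ^ (M * 6) * 1))  ∎
      where
      eq : ∀ t → 1 + t * 1 ≡ 1 * (1 * (1 + t * 1))
      eq = solve-∀
    X-growth (suc j) = begin
      2 ^ (M * ((suc j + 2) * (suc j + 3)))  ≤⟨ ^-monoʳ-≤ 2 (*-monoʳ-≤ M le) ⟩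
      2 ^ (M * (2 * ((j + 2) * (j + 3))))    ≡⟨ trans (cong (2 ^_) (eq M ((j + 2) * (j + 3)))) (^-distribˡ-+-* 2 (M * ((j + 2) * (j + 3))) _) ⟩
      2 ^ (M * ((j + 2) * (j + 3))) * 2 ^ (M * ((j + 2) * (j + 3)))  ≤⟨ *-mono-≤ (X-growth j) (X-growth j) ⟩
      X (suc j) * X (suc j)                  ≤⟨ *-monoʳ-≤ (X (suc j)) (<⇒≤ (X<Y (suc j))) ⟩
      X (suc (suc j))                        ∎
      where
      eq : ∀ m n → m * (2 * n) ≡ m * n + m * n
      eq = solve-∀
      le : (suc j + 2) * (suc j + 3) ≤ 2 * ((j + 2) * (j + 3))
      le = subst ((suc j + 2) * (suc j + 3) ≤_) (eq₂ j) (m≤m+n _ (j * (j + 3)))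
        where
        eq₂ : ∀ j → (suc j + 2) * (suc j + 3) + j * (j + 3) ≡ 2 * ((j + 2) * (j + 3))
        eq₂ = solve-∀

    X-large : ∀ j k → k ≤ M * ((j + 2) * (j + 3)) → 2 ^ k ≤ X (suc j)
    X-large j k le = ≤-trans (^-monoʳ-≤ 2 le) (X-growth j)

    -- The bound at `j` is what `minimal-step` needs to show that the multiplier 1 is admissible at
    -- `suc j`; the greedy search then preserves admissibility.
    X-upper : ∀ j → X (suc j) ^ j ≤ X j ^ a j
    X-upper zero    = m^n>0 1 (a 0)
    X-upper (suc j) = climb-holds (admissible? (suc j) (X (suc j)) (Y (suc j))) (X (suc j) ^ a (suc j)) 1
      (minimal-step {a j} {a (suc j)} {j} {suc j} {X j} {{>-nonZero (0<a j)}} refl (X-upper j)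
        (X-large j (a j * suc j) le) (slack j))
      where
      le : a j * suc j ≤ M * ((j + 2) * (j + 3))
      le = begin
        a j * suc j              ≤⟨ *-monoˡ-≤ (suc j) (a≤ j) ⟩
        M * suc j * suc j        ≡⟨ *-assoc M (suc j) (suc j) ⟩
        M * (suc j * suc j)      ≤⟨ *-monoʳ-≤ M (*-mono-≤ (≤-trans (n≤1+n (suc j)) (≤-reflexive (+-comm 2 j)))
                                                         (≤-trans (m≤n+m (suc j) 2) (≤-reflexive (+-comm 3 j)))) ⟩
        M * ((j + 2) * (j + 3))  ∎

    -- By maximality the next multiplier violates the upper bound, and it would at most double
    -- `X (suc (suc j))`. The resulting factor `2 ^ suc j` is absorbed by the extra `X (suc j)` on
    -- the right.
    X-lower : ∀ j → X j ^ a j ≤ X j * X (suc j) ^ j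
    X-lower zero = ≤-reflexive (^-zeroˡ (a 0))
    X-lower (suc j) = <⇒≤ (begin-strict
      x ^ a (suc j)                          <⟨ ≰⇒> (climb-maximal (admissible? (suc j) x y) (x ^ a (suc j)) 1 fuel) ⟩
      (x * (y * (1 + suc v * x))) ^ suc j    ≤⟨ ^-monoˡ-≤ (suc j) double ⟩
      (2 * X (suc (suc j))) ^ suc j          ≡⟨ ^-distribʳ-* 2 (X (suc (suc j))) (suc j) ⟩
      2 ^ suc j * X (suc (suc j)) ^ suc j    ≤⟨ *-monoˡ-≤ (X (suc (suc j)) ^ suc j) (X-large j (suc j) le) ⟩
      x * X (suc (suc j)) ^ suc j            ∎)
      where
      x y v : ℕ
      x = X (suc j)
      y = Y (suc j)
      v = u (suc j)
      double : x * (y * (1 + suc v * x)) ≤ 2 * X (suc (suc j))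
      double = begin
        x * (y * (1 + suc v * x))      ≤⟨ *-monoʳ-≤ x (*-monoʳ-≤ y (begin
          1 + (x + v * x)                      ≤⟨ +-monoʳ-≤ 1 (+-monoˡ-≤ (v * x) (begin
            x                                    ≡⟨ *-identityˡ x ⟨
            1 * x                                ≤⟨ *-monoˡ-≤ x (0<u (suc j)) ⟩
            v * x                                ∎)) ⟩
          1 + (v * x + v * x)                  ≤⟨ n≤1+n _ ⟩
          2 + (v * x + v * x)                  ≡⟨ eq (v * x) ⟩
          2 * (1 + v * x)                      ∎)) ⟩
        x * (y * (2 * (1 + v * x)))    ≡⟨ eq₂ x y (1 + v * x) ⟩
        2 * (x * (y * (1 + v * x)))    ∎
        where
        eq : ∀ t → 2 + (t + t) ≡ 2 * (1 + t)
        eq = solve-∀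
        eq₂ : ∀ x y t → x * (y * (2 * t)) ≡ 2 * (x * (y * t))
        eq₂ = solve-∀
      le : suc j ≤ M * ((j + 2) * (j + 3))
      le = begin
        suc j                    ≤⟨ n≤1+n (suc j) ⟩
        2 + j                    ≡⟨ +-comm 2 j ⟩
        j + 2                    ≡⟨ *-identityʳ (j + 2) ⟨
        (j + 2) * 1              ≤⟨ *-monoʳ-≤ (j + 2) (≤-trans (s≤s z≤n) (m≤n+m 3 j)) ⟩
        (j + 2) * (j + 3)        ≡⟨ *-identityˡ _ ⟨
        1 * ((j + 2) * (j + 3))  ≤⟨ *-monoˡ-≤ _ 0<M ⟩
        M * ((j + 2) * (j + 3))  ∎
      fuel : ¬ Admissible (suc j) x y (suc (x ^ a (suc j) + 1))
      fuel = <⇒≱ (begin-strict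
        x ^ a (suc j)                  <⟨ n<1+n _ ⟩
        suc (x ^ a (suc j))            ≡⟨ +-comm 1 _ ⟩
        x ^ a (suc j) + 1              <⟨ n<1+n _ ⟩
        t                              ≡⟨ *-identityʳ t ⟨
        t * 1                          ≤⟨ *-monoʳ-≤ t (0<X (suc j)) ⟩
        t * x                          ≤⟨ n≤1+n _ ⟩
        1 + t * x                      ≡⟨ *-identityˡ _ ⟨
        1 * (1 + t * x)                ≤⟨ *-monoˡ-≤ (1 + t * x) (0<Y (suc j)) ⟩
        y * (1 + t * x)                ≡⟨ *-identityˡ _ ⟨
        1 * (y * (1 + t * x))          ≤⟨ *-monoˡ-≤ (y * (1 + t * x)) (0<X (suc j)) ⟩
        z                              ≡⟨ *-identityʳ z ⟨
        z * 1                          ≤⟨ *-monoʳ-≤ z (m^n>0 z {{z≢0}} j) ⟩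
        z ^ suc j                      ∎)
        where
        t z : ℕ
        t = suc (x ^ a (suc j) + 1)
        z = x * (y * (1 + t * x))
        z≢0 : NonZero z
        z≢0 = >-nonZero (*-mono-≤ (0<X (suc j)) (*-mono-≤ (0<Y (suc j)) (s≤s z≤n)))

open Powers

open import Defs
open import Algebra.Bundles using (CommutativeRing)
import Algebra.Properties.CommutativeSemiring.Exp as Exp
open import Data.Integer.Base as ℤ using (ℤ; +_; -[1+_])
import Data.Integer.Properties as ℤ
import Data.Integer.Tactic.RingSolver as ℤ-Solver
open import Data.List.Base using (List; []; _∷_; cartesianProductWith; upTo)
open import Data.List.Membership.Propositional using (_∈_)
open import Data.List.Membership.Propositional.Properties using (∈-cartesianProductWith⁺; ∈-upTo⁺)
open import Data.List.Relation.Unary.All as All using (All; []; _∷_)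
open import Data.Nat.Base as ℕ using (ℕ; zero; suc; s≤s; z≤n)
open import Data.Nat.Coprimality using (Coprime; 1-coprimeTo; coprime-divisor) renaming (sym to coprime-sym)
open import Data.Nat.Divisibility using (_∣_; ∣-trans; ∣1⇒≡1; ∣m+n∣m⇒∣n; ∣n⇒∣m*n; m∣m*n)
import Data.Nat.DivMod as ℕ
import Data.Nat.Properties as ℕ
import Data.Nat.Tactic.RingSolver as ℕ-Solver
open import Data.Rational.Base
open import Data.Rational.Properties
import Data.Rational.Unnormalised.Base as ℚᵘ
import Data.Rational.Unnormalised.Properties as ℚᵘ
open import Data.Sum.Base using (_⊎_; inj₁; inj₂)
open import Data.Vec.Base using ([])
import Data.Vec.Relation.Unary.All as Vec
open import Function.Base using (_∘_)
open import Relation.Nullary.Decidable using (from-no; from-yes; dec⇒maybe)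
open import Tactic.RingSolver using (solve-∀)
open import Tactic.RingSolver.Core.AlmostCommutativeRing using (AlmostCommutativeRing; fromCommutativeRing)

-- Rational numbers

ℚ-ring : AlmostCommutativeRing _ _
ℚ-ring = fromCommutativeRing +-*-commutativeRing λ x → dec⇒maybe (0ℚ ≟ x)

<⇒≱ : ∀ {p q} → p < q → ¬ (q ≤ p)
<⇒≱ p<q q≤p = <-irrefl refl (<-≤-trans p<q q≤p)

fromℤ : ℤ → ℚ
fromℤ z = z / 1

toℚᵘ-fromℤ : ∀ z → toℚᵘ (fromℤ z) ℚᵘ.≃ ℚᵘ.mkℚᵘ z 0
toℚᵘ-fromℤ z = toℚᵘ-fromℚᵘ (ℚᵘ.mkℚᵘ z 0)

fromℤ-+ : ∀ x y → fromℤ (x ℤ.+ y) ≡ fromℤ x + fromℤ y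
fromℤ-+ x y = toℚᵘ-injective (begin
  toℚᵘ (fromℤ (x ℤ.+ y))             ≈⟨ toℚᵘ-fromℤ (x ℤ.+ y) ⟩
  ℚᵘ.mkℚᵘ (x ℤ.+ y) 0                ≈⟨ ℚᵘ.*≡* (eq x y) ⟩
  ℚᵘ.mkℚᵘ x 0 ℚᵘ.+ ℚᵘ.mkℚᵘ y 0       ≈⟨ ℚᵘ.+-cong (toℚᵘ-fromℤ x) (toℚᵘ-fromℤ y) ⟨
  toℚᵘ (fromℤ x) ℚᵘ.+ toℚᵘ (fromℤ y) ≈⟨ toℚᵘ-homo-+ (fromℤ x) (fromℤ y) ⟨
  toℚᵘ (fromℤ x + fromℤ y)           ∎)
  where
  open import Relation.Binary.Reasoning.Setoid ℚᵘ.≃-setoid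
  eq : ∀ x y → (x ℤ.+ y) ℤ.* + 1 ≡ (x ℤ.* + 1 ℤ.+ y ℤ.* + 1) ℤ.* + 1
  eq = ℤ-Solver.solve-∀

fromℤ-* : ∀ x y → fromℤ (x ℤ.* y) ≡ fromℤ x * fromℤ y
fromℤ-* x y = toℚᵘ-injective (begin
  toℚᵘ (fromℤ (x ℤ.* y))             ≈⟨ toℚᵘ-fromℤ (x ℤ.* y) ⟩
  ℚᵘ.mkℚᵘ x 0 ℚᵘ.* ℚᵘ.mkℚᵘ y 0       ≈⟨ ℚᵘ.*-cong (toℚᵘ-fromℤ x) (toℚᵘ-fromℤ y) ⟨
  toℚᵘ (fromℤ x) ℚᵘ.* toℚᵘ (fromℤ y) ≈⟨ toℚᵘ-homo-* (fromℤ x) (fromℤ y) ⟨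
  toℚᵘ (fromℤ x * fromℤ y)           ∎)
  where
  open import Relation.Binary.Reasoning.Setoid ℚᵘ.≃-setoid

fromℤ-mono-≤ : ∀ {x y} → x ℤ.≤ y → fromℤ x ≤ fromℤ y
fromℤ-mono-≤ {x} {y} le = toℚᵘ-cancel-≤ (begin
  toℚᵘ (fromℤ x)  ≃⟨ toℚᵘ-fromℤ x ⟩
  ℚᵘ.mkℚᵘ x 0     ≤⟨ ℚᵘ.*≤* (ℤ.*-monoʳ-≤-nonNeg (+ 1) le) ⟩
  ℚᵘ.mkℚᵘ y 0     ≃⟨ toℚᵘ-fromℤ y ⟨
  toℚᵘ (fromℤ y)  ∎)
  where open ℚᵘ.≤-Reasoning

fromℤ-cancel-≤ : ∀ {x y} → fromℤ x ≤ fromℤ y → x ℤ.≤ y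
fromℤ-cancel-≤ {x} {y} le = ℤ.*-cancelʳ-≤-pos x y (+ 1) (ℚᵘ.drop-*≤* (begin
  ℚᵘ.mkℚᵘ x 0     ≃⟨ toℚᵘ-fromℤ x ⟨
  toℚᵘ (fromℤ x)  ≤⟨ toℚᵘ-mono-≤ le ⟩
  toℚᵘ (fromℤ y)  ≃⟨ toℚᵘ-fromℤ y ⟩
  ℚᵘ.mkℚᵘ y 0     ∎))
  where open ℚᵘ.≤-Reasoning

fromℕ-+ : ∀ m n → fromℕ (m ℕ.+ n) ≡ fromℕ m + fromℕ n
fromℕ-+ m n = fromℤ-+ (+ m) (+ n)

fromℕ-* : ∀ m n → fromℕ (m ℕ.* n) ≡ fromℕ m * fromℕ n
fromℕ-* m n = trans (cong fromℤ (ℤ.pos-* m n)) (fromℤ-* (+ m) (+ n))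

fromℕ-^ : ∀ m n → fromℕ (m ℕ.^ n) ≡ fromℕ m ^ n
fromℕ-^ m zero    = refl
fromℕ-^ m (suc n) = trans (fromℕ-* m (m ℕ.^ n)) (cong (fromℕ m *_) (fromℕ-^ m n))

fromℕ-mono-≤ : ∀ {m n} → m ℕ.≤ n → fromℕ m ≤ fromℕ n
fromℕ-mono-≤ le = fromℤ-mono-≤ (ℤ.+≤+ le)

fromℕ-cancel-≤ : ∀ {m n} → fromℕ m ≤ fromℕ n → m ℕ.≤ n
fromℕ-cancel-≤ le = ℤ.drop‿+≤+ (fromℤ-cancel-≤ le)

fromℕ-mono-< : ∀ {m n} → m ℕ.< n → fromℕ m < fromℕ n
fromℕ-mono-< lt = ≰⇒> λ le → ℕ.<⇒≱ lt (fromℕ-cancel-≤ le)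

0≤fromℕ : ∀ n → 0ℚ ≤ fromℕ n
0≤fromℕ n = fromℕ-mono-≤ {0} {n} z≤n

0<1 : 0ℚ < 1ℚ
0<1 = fromℕ-mono-< {0} {1} (s≤s z≤n)

*-↧ₙ : ∀ r → r * fromℕ (↧ₙ r) ≡ fromℤ (↥ r)
*-↧ₙ r@(mkℚ n d _) = toℚᵘ-injective (begin
  toℚᵘ (r * fromℕ (suc d))                  ≈⟨ toℚᵘ-homo-* r (fromℕ (suc d)) ⟩
  toℚᵘ r ℚᵘ.* toℚᵘ (fromℕ (suc d))          ≈⟨ ℚᵘ.*-cong (ℚᵘ.≃-refl {toℚᵘ r}) (toℚᵘ-fromℤ (+ suc d)) ⟩
  ℚᵘ.mkℚᵘ n d ℚᵘ.* ℚᵘ.mkℚᵘ (+ suc d) 0      ≈⟨ ℚᵘ.*≡* (trans (ℤ.*-identityʳ (n ℤ.* + suc d)) (cong (λ k → n ℤ.* + k) (sym (ℕ.*-identityʳ (suc d))))) ⟩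
  ℚᵘ.mkℚᵘ n 0                               ≈⟨ toℚᵘ-fromℤ n ⟨
  toℚᵘ (fromℤ n)                            ∎)
  where
  open import Relation.Binary.Reasoning.Setoid ℚᵘ.≃-setoid

p≤q⇒0≤q-p : ∀ {p q} → p ≤ q → 0ℚ ≤ q - p
p≤q⇒0≤q-p {p} {q} le = subst (_≤ q - p) (+-inverseʳ p) (+-monoˡ-≤ (- p) le)

0≤q-p⇒p≤q : ∀ {p q} → 0ℚ ≤ q - p → p ≤ q
0≤q-p⇒p≤q {p} {q} le = subst₂ _≤_ (+-identityˡ p) (eq p q) (+-monoˡ-≤ p le)
  where
  eq : ∀ p q → q - p + p ≡ q
  eq = solve-∀ ℚ-ring

*-monoˡ : ∀ {p q} r → 0ℚ ≤ r → p ≤ q → p * r ≤ q * r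
*-monoˡ r 0≤r = *-monoʳ-≤-nonNeg r {{nonNegative 0≤r}}

*-monoʳ : ∀ {p q} r → 0ℚ ≤ r → p ≤ q → r * p ≤ r * q
*-monoʳ r 0≤r = *-monoˡ-≤-nonNeg r {{nonNegative 0≤r}}

*-mono : ∀ {p q r s} → 0ℚ ≤ q → 0ℚ ≤ r → p ≤ q → r ≤ s → p * r ≤ q * s
*-mono {q = q} {r} 0≤q 0≤r p≤q r≤s = ≤-trans (*-monoˡ r 0≤r p≤q) (*-monoʳ q 0≤q r≤s)

0≤+ : ∀ {p q} → 0ℚ ≤ p → 0ℚ ≤ q → 0ℚ ≤ p + q
0≤+ = +-mono-≤

0≤* : ∀ {p q} → 0ℚ ≤ p → 0ℚ ≤ q → 0ℚ ≤ p * q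
0≤* {p} {q} 0≤p 0≤q = subst (_≤ p * q) (*-zeroˡ q) (*-monoˡ q 0≤q 0≤p)

0<* : ∀ {p q} → 0ℚ < p → 0ℚ < q → 0ℚ < p * q
0<* {p} {q} 0<p 0<q = subst (_< p * q) (*-zeroˡ q) (*-monoˡ-<-pos q {{positive 0<q}} 0<p)

*-cancelʳ : ∀ p q {r} → 0ℚ < r → p * r ≤ q * r → p ≤ q
*-cancelʳ p q {r} 0<r = *-cancelʳ-≤-pos r {{positive 0<r}}

*-cancelʳ-≡ : ∀ p q {r} → 0ℚ < r → p * r ≡ q * r → p ≡ q
*-cancelʳ-≡ p q 0<r eq = ≤-antisym
  (*-cancelʳ p q 0<r (≤-reflexive eq)) (*-cancelʳ q p 0<r (≤-reflexive (sym eq)))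

^-mono-≤ : ∀ {p q} n → 0ℚ ≤ p → p ≤ q → p ^ n ≤ q ^ n
0≤^ : ∀ {p} n → 0ℚ ≤ p → 0ℚ ≤ p ^ n

^-mono-≤ zero    _   _   = ≤-refl
^-mono-≤ (suc n) 0≤p p≤q = *-mono (≤-trans 0≤p p≤q) (0≤^ n 0≤p) p≤q (^-mono-≤ n 0≤p p≤q)

0≤^ zero    _   = <⇒≤ 0<1
0≤^ (suc n) 0≤p = 0≤* 0≤p (0≤^ n 0≤p)

module ℚ-Exp = Exp (CommutativeRing.commutativeSemiring +-*-commutativeRing)

1^ : ∀ n → 1ℚ ^ n ≡ 1ℚ
1^ zero    = refl
1^ (suc n) = trans (*-identityˡ (1ℚ ^ n)) (1^ n)

inv-* : ∀ {n} → 0 ℕ.< n → inv (fromℕ n) * fromℕ n ≡ 1ℚ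
inv-* {n} 0<n = inverse (fromℕ n) (fromℕ-mono-< 0<n)
  where
  inverse : ∀ p → 0ℚ < p → inv p * p ≡ 1ℚ
  inverse p@(mkℚ (+ zero)  _ _) 0<p = contradiction (↥p≡0⇒p≡0 p refl) (≢-sym (<⇒≢ 0<p))
  inverse p@(mkℚ (+ suc _) _ _) 0<p = *-inverseˡ p
  inverse p@(mkℚ -[1+ _ ]  _ _) 0<p = *-inverseˡ p

0<inv : ∀ {n} → 0 ℕ.< n → 0ℚ < inv (fromℕ n)
0<inv {n} 0<n = ≰⇒> λ le → <⇒≱ 0<1 (begin
  1ℚ                       ≡⟨ inv-* 0<n ⟨
  inv (fromℕ n) * fromℕ n  ≤⟨ *-monoˡ (fromℕ n) (0≤fromℕ n) le ⟩
  0ℚ * fromℕ n             ≡⟨ *-zeroˡ (fromℕ n) ⟩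
  0ℚ                       ∎)
  where open ≤-Reasoning

inv-cancel : ∀ {n} p → 0 ℕ.< n → p * fromℕ n * inv (fromℕ n) ≡ p
inv-cancel {n} p 0<n = trans (eq p (fromℕ n) (inv (fromℕ n))) (trans (cong (p *_) (inv-* 0<n)) (*-identityʳ p))
  where
  eq : ∀ p n i → p * n * i ≡ p * (i * n)
  eq = solve-∀ ℚ-ring

p≤∣p∣ : ∀ p → p ≤ ∣ p ∣
p≤∣p∣ p with ≤-total 0ℚ p
... | inj₁ 0≤p = ≤-reflexive (sym (0≤p⇒∣p∣≡p 0≤p))
... | inj₂ p≤0 = ≤-trans p≤0 (0≤∣p∣ p)

∣∣-sym : ∀ p q → ∣ p - q ∣ ≡ ∣ q - p ∣
∣∣-sym p q = trans (sym (∣-p∣≡∣p∣ (p - q))) (cong ∣_∣ (eq p q))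
  where
  eq : ∀ p q → - (p - q) ≡ q - p
  eq = solve-∀ ℚ-ring

∣∣-≤ : ∀ {p q} → p ≤ q → - p ≤ q → ∣ p ∣ ≤ q
∣∣-≤ {p} p≤q -p≤q with ∣p∣≡p∨∣p∣≡-p p
... | inj₁ eq = subst (_≤ _) (sym eq) p≤q
... | inj₂ eq = subst (_≤ _) (sym eq) -p≤q

1≤∣fromℤ∣ : ∀ z → z ≢ + 0 → 1ℚ ≤ ∣ fromℤ z ∣
1≤∣fromℤ∣ (+ zero)    z≢0 = contradiction refl z≢0
1≤∣fromℤ∣ (+ suc n)   _   = ≤-trans (fromℕ-mono-≤ {1} {suc n} (s≤s z≤n)) (p≤∣p∣ (fromℕ (suc n)))
1≤∣fromℤ∣ -[1+ n ]    _   = ≤-trans (fromℕ-mono-≤ {1} {suc n} (s≤s z≤n))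
  (≤-trans (p≤∣p∣ (fromℕ (suc n))) (≤-reflexive (sym (∣-p∣≡∣p∣ (fromℕ (suc n))))))

0<↧ₙ : ∀ r → 0ℚ < fromℕ (↧ₙ r)
0<↧ₙ (mkℚ _ d _) = fromℕ-mono-< {0} {suc d} (s≤s z≤n)

-- Multiplied by both denominators, the difference becomes a nonzero integer.
1≤∣r-s∣*↧ₙ : ∀ {r s} → r ≢ s → 1ℚ ≤ ∣ r - s ∣ * (fromℕ (↧ₙ r) * fromℕ (↧ₙ s))
1≤∣r-s∣*↧ₙ {r} {s} r≢s = begin
  1ℚ                     ≤⟨ 1≤∣fromℤ∣ z z≢0 ⟩
  ∣ fromℤ z ∣            ≡⟨ cong ∣_∣ z≡ ⟩
  ∣ (r - s) * (Q * X) ∣  ≡⟨ ∣p*q∣≡∣p∣*∣q∣ (r - s) (Q * X) ⟩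
  ∣ r - s ∣ * ∣ Q * X ∣  ≡⟨ cong (∣ r - s ∣ *_) (0≤p⇒∣p∣≡p (<⇒≤ 0<QX)) ⟩
  ∣ r - s ∣ * (Q * X)    ∎
  where
  open ≤-Reasoning
  Q X : ℚ
  Q = fromℕ (↧ₙ r)
  X = fromℕ (↧ₙ s)
  0<QX : 0ℚ < Q * X
  0<QX = 0<* (0<↧ₙ r) (0<↧ₙ s)
  z : ℤ
  z = ↥ r ℤ.* + ↧ₙ s ℤ.+ ↥ s ℤ.* ℤ.- + ↧ₙ r
  fromℤ-neg : ∀ n → fromℤ (ℤ.- + n) ≡ - fromℕ n
  fromℤ-neg zero    = refl
  fromℤ-neg (suc n) = refl
  eq : ∀ r s Q X → r * Q * X + s * X * - Q ≡ (r - s) * (Q * X)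
  eq = solve-∀ ℚ-ring
  z≡ : fromℤ z ≡ (r - s) * (Q * X)
  z≡ = trans (fromℤ-+ (↥ r ℤ.* + ↧ₙ s) (↥ s ℤ.* ℤ.- + ↧ₙ r)) (trans (cong₂ _+_
    (trans (fromℤ-* (↥ r) (+ ↧ₙ s)) (cong (_* X) (sym (*-↧ₙ r))))
    (trans (fromℤ-* (↥ s) (ℤ.- + ↧ₙ r)) (cong₂ _*_ (sym (*-↧ₙ s)) (fromℤ-neg (↧ₙ r)))))
    (eq r s Q X))
  eq₂ : ∀ r s → (r - s) + s ≡ r
  eq₂ = solve-∀ ℚ-ring
  z≢0 : z ≢ + 0
  z≢0 z≡0 = r≢s (trans (sym (eq₂ r s)) (trans (cong (_+ s) r-s≡0) (+-identityˡ s)))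
    where
    [r-s]QX≡0 : (r - s) * (Q * X) ≡ 0ℚ * (Q * X)
    [r-s]QX≡0 = trans (sym z≡) (trans (cong fromℤ z≡0) (sym (*-zeroˡ (Q * X))))
    r-s≡0 : r - s ≡ 0ℚ
    r-s≡0 = *-cancelʳ-≡ (r - s) 0ℚ 0<QX [r-s]QX≡0

p≤∣↥p∣ : ∀ p → p ≤ fromℕ ℤ.∣ ↥ p ∣
p≤∣↥p∣ p@(mkℚ (+ n)    d _) = begin
  p                    ≡⟨ *-identityʳ p ⟨
  p * 1ℚ               ≤⟨ *-monoʳ p (nonNegative⁻¹ p) (fromℕ-mono-≤ {1} {suc d} (s≤s z≤n)) ⟩
  p * fromℕ (suc d)    ≡⟨ *-↧ₙ p ⟩
  fromℕ n              ∎
  where open ≤-Reasoning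
p≤∣↥p∣ p@(mkℚ -[1+ n ] d _) = ≤-trans (<⇒≤ (negative⁻¹ p)) (0≤fromℕ (suc n))

archimedean : ∀ {ε} → 0ℚ < ε → 1ℚ ≤ ε * fromℕ (↧ₙ ε)
archimedean {ε@(mkℚ (+ zero)  d _)} 0<ε = contradiction (↥p≡0⇒p≡0 ε refl) (≢-sym (<⇒≢ 0<ε))
archimedean {ε@(mkℚ (+ suc n) d _)} _   = ≤-trans (fromℕ-mono-≤ {1} {suc n} (s≤s z≤n)) (≤-reflexive (sym (*-↧ₙ ε)))
archimedean {ε@(mkℚ -[1+ n ]  d _)} 0<ε = contradiction (negative⁻¹ ε) (<-asym 0<ε)

-- Properties of all sufficiently late indices.

Eventually : (ℕ → Set) → Set
Eventually P = ∃ λ N → ∀ n → N ℕ.≤ n → P n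

infixl 4 _<$>_ _<*>_

_<$>_ : {P Q : ℕ → Set} → (∀ {n} → P n → Q n) → Eventually P → Eventually Q
f <$> (N , h) = N , λ n le → f (h n le)

_<*>_ : {P Q : ℕ → Set} → Eventually (λ n → P n → Q n) → Eventually P → Eventually Q
(M , f) <*> (N , h) = M ℕ.⊔ N , λ n le → f n (ℕ.m⊔n≤o⇒m≤o M N le) (h n (ℕ.m⊔n≤o⇒n≤o M N le))

sometime : {P : ℕ → Set} → Eventually P → ∃ P
sometime (N , h) = N , h N ℕ.≤-refl

-- The series

coprime-* : ∀ {m a b} → Coprime m a → Coprime m b → Coprime m (a ℕ.* b)
coprime-* m⊥a m⊥b (d∣m , d∣ab) =
  m⊥b (d∣m , coprime-divisor (λ (e∣d , e∣a) → m⊥a (∣-trans e∣d d∣m , e∣a)) d∣ab)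

↧ₙ-unique : ∀ {r n d} → Coprime n d → 0 ℕ.< d → r * fromℕ d ≡ fromℕ n → ↧ₙ r ≡ d
↧ₙ-unique {r} {n} {suc d} n⊥d _ eq =
  cong ↧ₙ_ (*-cancelʳ-≡ r s (0<↧ₙ s) (trans eq (sym (*-↧ₙ s))))
  where
  s : ℚ
  s = mkℚ (+ n) d n⊥d

-- Built in reduced form so that its denominator computes to 1 for a variable `i`; the normalisation
-- in `fromℕ i` would be stuck.
integer : ℕ → ℚ
integer i = mkℚ (+ i) 0 (coprime-sym (1-coprimeTo i))

integer≡fromℕ : ∀ i → integer i ≡ fromℕ i
integer≡fromℕ i = sym (normalize-coprime (coprime-sym (1-coprimeTo i)))

module Series
  (i : ℕ) (X Y : ℕ → ℕ)
  (X₀ : X 0 ≡ 1)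
  (X-suc : ∀ j → X (suc j) ≡ X j ℕ.* Y (suc j))
  (Y∣Y : ∀ j → Y (suc j) ∣ Y (suc (suc j)))
  (0<X : ∀ j → 0 ℕ.< X j)
  (X<Y : ∀ j → X j ℕ.< Y (suc j))
  where

  S : ℕ → ℚ
  S N = integer i + ∑< N (λ k → inv (fromℕ (X (suc k))))

  num : ℕ → ℕ
  num zero    = i
  num (suc j) = num j ℕ.* Y (suc j) ℕ.+ 1

  S-num : ∀ j → S j * fromℕ (X j) ≡ fromℕ (num j)
  S-num zero = begin
    (integer i + 0ℚ) * fromℕ (X 0)  ≡⟨ cong₂ _*_ (+-identityʳ (integer i)) (cong fromℕ X₀) ⟩
    integer i * 1ℚ                  ≡⟨ *-identityʳ (integer i) ⟩
    integer i                       ≡⟨ integer≡fromℕ i ⟩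
    fromℕ i                         ∎
    where open ≡-Reasoning
  S-num (suc j) = begin
    (p + (s + inv X′)) * X′               ≡⟨ eq p s (inv X′) X′ ⟩
    (p + s) * X′ + inv X′ * X′            ≡⟨ cong₂ _+_ (cong (S j *_) (trans (cong fromℕ (X-suc j)) (fromℕ-* (X j) (Y (suc j))))) (inv-* (0<X (suc j))) ⟩
    S j * (fromℕ (X j) * Y′) + 1ℚ         ≡⟨ cong (_+ 1ℚ) (*-assoc (S j) (fromℕ (X j)) Y′) ⟨
    S j * fromℕ (X j) * Y′ + 1ℚ           ≡⟨ cong (λ t → t * Y′ + 1ℚ) (S-num j) ⟩
    fromℕ (num j) * Y′ + 1ℚ               ≡⟨ cong (_+ 1ℚ) (fromℕ-* (num j) (Y (suc j))) ⟨
    fromℕ (num j ℕ.* Y (suc j)) + 1ℚ      ≡⟨ fromℕ-+ (num j ℕ.* Y (suc j)) 1 ⟨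
    fromℕ (num (suc j))                   ∎
    where
    open ≡-Reasoning
    p s X′ Y′ : ℚ
    p  = integer i
    s  = ∑< j (λ k → inv (fromℕ (X (suc k))))
    X′ = fromℕ (X (suc j))
    Y′ = fromℕ (Y (suc j))
    eq : ∀ p s v x → (p + (s + v)) * x ≡ (p + s) * x + v * x
    eq = solve-∀ ℚ-ring

  -- Every prime factor of X (suc j) divides Y (suc j).
  coprime-Y⇒coprime-X : ∀ {m} j → Coprime m (Y (suc j)) → Coprime m (X (suc j))
  coprime-Y⇒coprime-X {m} zero m⊥Y = subst (Coprime m)
    (sym (trans (X-suc 0) (trans (cong (ℕ._* Y 1) X₀) (ℕ.*-identityˡ (Y 1))))) m⊥Y
  coprime-Y⇒coprime-X {m} (suc j) m⊥Y = subst (Coprime m) (sym (X-suc (suc j)))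
    (coprime-* (coprime-Y⇒coprime-X j λ (d∣m , d∣Y) → m⊥Y (d∣m , ∣-trans d∣Y (Y∣Y j))) m⊥Y)

  -- `num (suc j)` is 1 modulo `Y (suc j)`, so it is coprime to `Y (suc j)` and therefore to
  -- `X (suc j)`.
  num-coprime : ∀ j → Coprime (num j) (X j)
  num-coprime zero    = subst (Coprime i) (sym X₀) (coprime-sym (1-coprimeTo i))
  num-coprime (suc j) = coprime-Y⇒coprime-X j λ (d∣num , d∣Y) →
    ∣1⇒≡1 (∣m+n∣m⇒∣n d∣num (∣n⇒∣m*n (num j) d∣Y))

  ↧ₙ-S : ∀ j → ↧ₙ (S j) ≡ X j
  ↧ₙ-S j = ↧ₙ-unique {S j} {num j} {X j} (num-coprime j) (0<X j) (S-num j)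

  -- Only the first omitted term of the series; the whole remainder lies between it and its double.
  tail : ℕ → ℚ
  tail j = inv (fromℕ (X (suc j)))

  0<tail : ∀ j → 0ℚ < tail j
  0<tail j = 0<inv (0<X (suc j))

  S-suc : ∀ j → S (suc j) ≡ S j + tail j
  S-suc j = sym (+-assoc (integer i) (∑< j (λ k → inv (fromℕ (X (suc k))))) (tail j))

  tail-halves : ∀ j → tail (suc j) + tail (suc j) ≤ tail j
  tail-halves j = begin
    t′ + t′                       ≡⟨ inv-cancel (t′ + t′) (0<X (suc j)) ⟨
    (t′ + t′) * x * inv x         ≡⟨ cong (_* inv x) (eq t′ x) ⟩
    t′ * (x + x) * inv x          ≤⟨ *-monoˡ (inv x) (<⇒≤ (0<tail j)) (*-monoʳ t′ (<⇒≤ (0<tail (suc j))) le) ⟩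
    t′ * x′ * inv x               ≡⟨ cong (_* inv x) (inv-* (0<X (suc (suc j)))) ⟩
    1ℚ * inv x                    ≡⟨ *-identityˡ (inv x) ⟩
    inv x                         ∎
    where
    open ≤-Reasoning
    x x′ t′ : ℚ
    x  = fromℕ (X (suc j))
    x′ = fromℕ (X (suc (suc j)))
    t′ = tail (suc j)
    eq : ∀ t x → (t + t) * x ≡ t * (x + x)
    eq = solve-∀ ℚ-ring
    double : ∀ x → x ℕ.+ x ≡ x ℕ.* 2
    double = ℕ-Solver.solve-∀
    le : x + x ≤ x′
    le = subst (_≤ x′) (fromℕ-+ (X (suc j)) (X (suc j)))
      (fromℕ-mono-≤ {X (suc j) ℕ.+ X (suc j)} {X (suc (suc j))}
        (subst₂ ℕ._≤_ (sym (double (X (suc j)))) (sym (X-suc (suc j)))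
          (ℕ.*-monoʳ-≤ (X (suc j)) (ℕ.≤-trans (s≤s (0<X (suc j))) (X<Y (suc j))))))

  S-mono : ∀ {j n} → j ℕ.≤ n → S j ≤ S n
  S-mono = go ∘ ℕ.≤⇒≤′
    where
    open ≤-Reasoning
    go : ∀ {j n} → j ℕ.≤′ n → S j ≤ S n
    go ℕ.≤′-refl = ≤-refl
    go {j} {suc n} (ℕ.≤′-step le) = begin
      S j           ≤⟨ go le ⟩
      S n           ≡⟨ +-identityʳ (S n) ⟨
      S n + 0ℚ      ≤⟨ +-monoʳ-≤ (S n) (<⇒≤ (0<tail n)) ⟩
      S n + tail n  ≡⟨ S-suc n ⟨
      S (suc n)     ∎

  S-lower : ∀ {j n} → j ℕ.< n → S j + tail j ≤ S n
  S-lower {j} {n} j<n = subst (_≤ S n) (S-suc j) (S-mono j<n)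

  -- Since each term is at most half of the one before, `S n + (tail n + tail n)` does not increase
  -- with `n`.
  S-upper : ∀ {j n} → j ℕ.≤ n → S n ≤ S j + (tail j + tail j)
  S-upper {j} {n} le = ≤-trans (begin
    S n                        ≡⟨ +-identityʳ (S n) ⟨
    S n + 0ℚ                   ≤⟨ +-monoʳ-≤ (S n) (0≤+ (<⇒≤ (0<tail n)) (<⇒≤ (0<tail n))) ⟩
    S n + (tail n + tail n)    ∎) (go (ℕ.≤⇒≤′ le))
    where
    open ≤-Reasoning
    eq : ∀ s t → s + t + t ≡ s + (t + t)
    eq = solve-∀ ℚ-ring
    go : ∀ {n} → j ℕ.≤′ n → S n + (tail n + tail n) ≤ S j + (tail j + tail j)
    go ℕ.≤′-refl = ≤-refl
    go {suc n} (ℕ.≤′-step le) = begin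
      S (suc n) + (tail (suc n) + tail (suc n))  ≤⟨ +-monoʳ-≤ (S (suc n)) (tail-halves n) ⟩
      S (suc n) + tail n                         ≡⟨ cong (_+ tail n) (S-suc n) ⟩
      S n + tail n + tail n                      ≡⟨ eq (S n) (tail n) ⟩
      S n + (tail n + tail n)                    ≤⟨ go le ⟩
      S j + (tail j + tail j)                    ∎

  n<X : ∀ n → n ℕ.< X (suc n)
  X<X : ∀ n → X n ℕ.< X (suc n)
  X<X n = begin-strict
    X n                  <⟨ X<Y n ⟩
    Y (suc n)            ≡⟨ ℕ.*-identityˡ (Y (suc n)) ⟨
    1 ℕ.* Y (suc n)      ≤⟨ ℕ.*-monoˡ-≤ (Y (suc n)) (0<X n) ⟩
    X n ℕ.* Y (suc n)    ≡⟨ X-suc n ⟨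
    X (suc n)            ∎
    where open ℕ.≤-Reasoning
  n<X zero    = 0<X 1
  n<X (suc n) = ℕ.≤-<-trans (n<X n) (X<X (suc n))

  tail-small : ∀ {ε} → 0ℚ < ε → ∃ λ j → tail j + tail j < ε
  tail-small {ε} 0<ε = j , (begin-strict
    tail j + tail j               ≡⟨ inv-cancel (tail j + tail j) (0<↧ₙ-ℕ ε) ⟨
    (tail j + tail j) * d * inv d ≡⟨ cong (_* inv d) (eq (tail j) d) ⟩
    tail j * (d + d) * inv d      <⟨ *-monoˡ-<-pos (inv d) {{positive (0<inv (0<↧ₙ-ℕ ε))}} lt ⟩
    1ℚ * inv d                    ≤⟨ *-monoˡ (inv d) (<⇒≤ (0<inv (0<↧ₙ-ℕ ε))) (archimedean 0<ε) ⟩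
    ε * d * inv d                 ≡⟨ inv-cancel ε (0<↧ₙ-ℕ ε) ⟩
    ε                             ∎)
    where
    open ≤-Reasoning
    0<↧ₙ-ℕ : ∀ r → 0 ℕ.< ↧ₙ r
    0<↧ₙ-ℕ (mkℚ _ _ _) = s≤s z≤n
    j : ℕ
    -- With d the denominator of ε, this is 2d, and `X (suc j)` exceeds it. Hence twice the tail is
    -- below 1/d, which is at most ε.
    j = ↧ₙ ε ℕ.+ ↧ₙ ε
    d : ℚ
    d = fromℕ (↧ₙ ε)
    eq : ∀ t d → (t + t) * d ≡ t * (d + d)
    eq = solve-∀ ℚ-ring
    lt : tail j * (d + d) < 1ℚ
    lt = begin-strict
      tail j * (d + d)            ≡⟨ cong (tail j *_) (fromℕ-+ (↧ₙ ε) (↧ₙ ε)) ⟨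
      tail j * fromℕ j            <⟨ *-monoʳ-<-pos (tail j) {{positive (0<tail j)}} (fromℕ-mono-< {j} {X (suc j)} (n<X j)) ⟩
      tail j * fromℕ (X (suc j))  ≡⟨ inv-* (0<X (suc j)) ⟩
      1ℚ                          ∎

  S-close : ∀ {j m n} → j ℕ.≤ m → j ℕ.≤ n → ∣ S m - S n ∣ ≤ tail j + tail j
  S-close {j} {m} {n} j≤m j≤n = ∣∣-≤ (close j≤m j≤n) (subst (_≤ t) (flip (S m) (S n)) (close j≤n j≤m))
    where
    t : ℚ
    t = tail j + tail j
    flip : ∀ p q → q - p ≡ - (p - q)
    flip = solve-∀ ℚ-ring
    eq : ∀ s t → s + t - s ≡ t
    eq = solve-∀ ℚ-ring
    close : ∀ {m n} → j ℕ.≤ m → j ℕ.≤ n → S m - S n ≤ t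
    close {m} {n} j≤m j≤n = begin
      S m - S n        ≤⟨ +-mono-≤ (S-upper j≤m) (neg-antimono-≤ (S-mono j≤n)) ⟩
      S j + t - S j    ≡⟨ eq (S j) t ⟩
      t                ∎
      where open ≤-Reasoning

  S-cauchy : Cauchy S
  S-cauchy ε 0<ε = let j , small = tail-small 0<ε in
    j , λ m n j≤m j≤n → ≤-<-trans (S-close j≤m j≤n) small

  α : ℝ
  α = mkℝ S S-cauchy

-- Rational approximations of ν

/-* : ∀ a n → (+ a / suc n) * fromℕ (suc n) ≡ fromℕ a
/-* a n = toℚᵘ-injective (begin
  toℚᵘ ((+ a / suc n) * fromℕ (suc n))             ≈⟨ toℚᵘ-homo-* (+ a / suc n) (fromℕ (suc n)) ⟩
  toℚᵘ (+ a / suc n) ℚᵘ.* toℚᵘ (fromℕ (suc n))     ≈⟨ ℚᵘ.*-cong (toℚᵘ-fromℚᵘ (ℚᵘ.mkℚᵘ (+ a) n)) (toℚᵘ-fromℤ (+ suc n)) ⟩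
  ℚᵘ.mkℚᵘ (+ a) n ℚᵘ.* ℚᵘ.mkℚᵘ (+ suc n) 0         ≈⟨ ℚᵘ.*≡* (trans (ℤ.*-identityʳ (+ a ℤ.* + suc n)) (cong (λ k → + a ℤ.* + k) (sym (ℕ.*-identityʳ (suc n))))) ⟩
  ℚᵘ.mkℚᵘ (+ a) 0                                  ≈⟨ toℚᵘ-fromℤ (+ a) ⟨
  toℚᵘ (fromℕ a)                                   ∎)
  where
  open import Relation.Binary.Reasoning.Setoid ℚᵘ.≃-setoid

-- Otherwise, with `N` for n + 1 and `f` for the integer square root of c N², the product `D * N`
-- would be at least f + 1, and its square would be both at most c N² and more than that.
√-upper : ∀ c D n → D * D ≤ fromℕ c → D ≤ √-seq c n + inv (fromℕ (suc n))
√-upper c D n D²≤c = ≮⇒≥ λ lt → <⇒≱ (fromℕ-mono-< {c ℕ.* (suc n ℕ.* suc n)} {suc f ℕ.* suc f} (⌊√⌋-upper (c ℕ.* (suc n ℕ.* suc n)))) (begin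
  fromℕ (suc f ℕ.* suc f)            ≡⟨ fromℕ-* (suc f) (suc f) ⟩
  fromℕ (suc f) * fromℕ (suc f)      ≤⟨ *-mono (≤-trans (0≤fromℕ (suc f)) (f<DN lt)) (0≤fromℕ (suc f)) (f<DN lt) (f<DN lt) ⟩
  (D * N) * (D * N)                  ≡⟨ eq₁ D N ⟩
  (D * D) * (N * N)                  ≤⟨ *-monoˡ (N * N) (0≤* (0≤fromℕ (suc n)) (0≤fromℕ (suc n))) D²≤c ⟩
  fromℕ c * (N * N)                  ≡⟨ cong (fromℕ c *_) (fromℕ-* (suc n) (suc n)) ⟨
  fromℕ c * fromℕ (suc n ℕ.* suc n)  ≡⟨ fromℕ-* c (suc n ℕ.* suc n) ⟨
  fromℕ (c ℕ.* (suc n ℕ.* suc n))    ∎)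
  where
  open ≤-Reasoning
  f : ℕ
  f = ⌊√ c ℕ.* (suc n ℕ.* suc n) ⌋
  N : ℚ
  N = fromℕ (suc n)
  eq₁ : ∀ D N → (D * N) * (D * N) ≡ (D * D) * (N * N)
  eq₁ = solve-∀ ℚ-ring
  f<DN : √-seq c n + inv N < D → fromℕ (suc f) ≤ D * N
  f<DN lt = begin
    fromℕ (suc f)                   ≡⟨ fromℕ-+ 1 f ⟩
    1ℚ + fromℕ f                    ≡⟨ +-comm 1ℚ (fromℕ f) ⟩
    fromℕ f + 1ℚ                    ≡⟨ cong₂ _+_ (/-* f n) (inv-* {suc n} (s≤s z≤n)) ⟨
    √-seq c n * N + inv N * N       ≡⟨ *-distribʳ-+ N (√-seq c n) (inv N) ⟨
    (√-seq c n + inv N) * N         ≤⟨ *-monoˡ N (0≤fromℕ (suc n)) (<⇒≤ lt) ⟩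
    D * N                           ∎

inv-small : ∀ {ε} → 0ℚ < ε → Eventually (λ n → inv (fromℕ (suc n)) ≤ ε)
inv-small {ε} 0<ε = ↧ₙ ε , λ n le → *-cancelʳ (inv (fromℕ (suc n))) ε (fromℕ-mono-< {0} {suc n} (s≤s z≤n)) (begin
  inv (fromℕ (suc n)) * fromℕ (suc n)  ≡⟨ inv-* {suc n} (s≤s z≤n) ⟩
  1ℚ                                   ≤⟨ archimedean 0<ε ⟩
  ε * fromℕ (↧ₙ ε)                     ≤⟨ *-monoʳ ε (<⇒≤ 0<ε) (fromℕ-mono-≤ {↧ₙ ε} {suc n} (ℕ.≤-trans le (ℕ.n≤1+n n))) ⟩
  ε * fromℕ (suc n)                    ∎)
  where open ≤-Reasoning

0<½* : ∀ {ε} → 0ℚ < ε → 0ℚ < ½ * ε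
0<½* 0<ε = 0<* (from-yes (0ℚ <? ½)) 0<ε

⌊_⌋ℕ : ℚ → ℕ
⌊ p ⌋ℕ = ℤ.∣ ↥ p ∣ ℕ./ suc (ℚ.denominator-1 p)

floor-upper : ∀ {p} → 0ℚ ≤ p → p ≤ fromℕ (suc ⌊ p ⌋ℕ)
floor-upper {p@(mkℚ (+ n)    d _)} _   = *-cancelʳ p (fromℕ (suc ⌊ p ⌋ℕ)) (0<↧ₙ p) (begin
  p * fromℕ (suc d)                          ≡⟨ *-↧ₙ p ⟩
  fromℕ n                                    ≤⟨ fromℕ-mono-≤ {n} {suc ⌊ p ⌋ℕ ℕ.* suc d} le ⟩
  fromℕ (suc ⌊ p ⌋ℕ ℕ.* suc d)            ≡⟨ fromℕ-* (suc ⌊ p ⌋ℕ) (suc d) ⟩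
  fromℕ (suc ⌊ p ⌋ℕ) * fromℕ (suc d)      ∎)
  where
  open ≤-Reasoning
  le : n ℕ.≤ suc ⌊ p ⌋ℕ ℕ.* suc d
  le = ℕ.≤-trans (ℕ.≤-reflexive (ℕ.m≡m%n+[m/n]*n n (suc d))) (ℕ.+-monoˡ-≤ _ (ℕ.<⇒≤ (ℕ.m%n<n n (suc d))))
floor-upper {p@(mkℚ -[1+ n ] d _)} 0≤p = contradiction 0≤p (<⇒≱ (negative⁻¹ p))

floor-lower : ∀ {p} → 0ℚ ≤ p → fromℕ ⌊ p ⌋ℕ ≤ p
floor-lower {p@(mkℚ (+ n)    d _)} _   = *-cancelʳ (fromℕ ⌊ p ⌋ℕ) p (0<↧ₙ p) (begin
  fromℕ ⌊ p ⌋ℕ * fromℕ (suc d)            ≡⟨ fromℕ-* ⌊ p ⌋ℕ (suc d) ⟨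
  fromℕ (⌊ p ⌋ℕ ℕ.* suc d)                  ≤⟨ fromℕ-mono-≤ {⌊ p ⌋ℕ ℕ.* suc d} {n} (ℕ.m/n*n≤m n (suc d)) ⟩
  fromℕ n                                    ≡⟨ *-↧ₙ p ⟨
  p * fromℕ (suc d)                          ∎)
  where open ≤-Reasoning
floor-lower {p@(mkℚ -[1+ n ] d _)} 0≤p = contradiction 0≤p (<⇒≱ (negative⁻¹ p))

2ℚ 3ℚ 4ℚ 5ℚ ¼ : ℚ
2ℚ = 1ℚ + 1ℚ
3ℚ = 2ℚ + 1ℚ
4ℚ = 3ℚ + 1ℚ
5ℚ = 4ℚ + 1ℚ
¼  = ½ * ½

bound : ℝ → ℕ
bound x = suc ℤ.∣ ↥ (seq x (proj₁ (cauchy x 1ℚ 0<1))) ∣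

≤bound : ∀ x → Eventually (λ n → seq x n ≤ fromℕ (bound x))
≤bound x = N , λ n le → 0≤q-p⇒p≤q (subst (0ℚ ≤_)
  (trans (eq (seq x n) (seq x N) (fromℕ k)) (cong (_- seq x n) (sym (fromℕ-+ 1 k))))
  (0≤+ (p≤q⇒0≤q-p (≤-trans (p≤∣p∣ (seq x n - seq x N)) (<⇒≤ (proj₂ (cauchy x 1ℚ 0<1) n N le ℕ.≤-refl))))
       (p≤q⇒0≤q-p (p≤∣↥p∣ (seq x N)))))
  where
  N k : ℕ
  N = proj₁ (cauchy x 1ℚ 0<1)
  k = ℤ.∣ ↥ (seq x N) ∣
  eq : ∀ v s k → 1ℚ - (v - s) + (k - s) ≡ 1ℚ + k - v
  eq = solve-∀ ℚ-ring

-- Consequences of ν ≥ (3 + √5)/2 for rationals above ν.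

module AboveGolden (ν : ℝ) (φ²≤ν : ⟨3+√5⟩/2 ≤ᴿ ν) where

  -- If T² + 1 < 3T, then (2T - 3)² < 5 because 4(3T - T² - 1) = 5 - (2T - 3)². This puts T, and
  -- with it ν + ε, at or below (3 + √5)/2, against the hypothesis. Half of ε pays for the error of
  -- the approximations to √5.
  golden : ∀ T → ν <ᴿ fromℚ T → 3ℚ * T ≤ T * T + 1ℚ
  golden T (ε , 0<ε , below) = ≮⇒≥ λ lt → φ²≤ν (½ * ε , 0<½* 0<ε ,
    ((λ {n} h small → 0≤q-p⇒p≤q (subst (0ℚ ≤_) (eq₁ (seq ν n) ε T (√-seq 5 n) (inv (fromℕ (suc n))))
      (0≤+ (p≤q⇒0≤q-p h) (0≤* (from-yes (0ℚ ≤? ½)) (0≤+ (p≤q⇒0≤q-p (√-upper 5 (2ℚ * T - 3ℚ) n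
        (0≤q-p⇒p≤q (subst (0ℚ ≤_) (eq₂ T) (0≤* {4ℚ} (from-yes (0ℚ ≤? 4ℚ)) (p≤q⇒0≤q-p (<⇒≤ lt)))))))
        (p≤q⇒0≤q-p small)))))) <$> below <*> inv-small 0<ε))
    where
    eq₁ : ∀ v e T r i → (T - (v + e)) + ½ * ((r + i - (2ℚ * T - 3ℚ)) + (e - i)) ≡ ½ * (3ℚ + r) - (v + ½ * e)
    eq₁ = solve-∀ ℚ-ring
    eq₂ : ∀ T → 4ℚ * (3ℚ * T - (T * T + 1ℚ)) ≡ 5ℚ - (2ℚ * T - 3ℚ) * (2ℚ * T - 3ℚ)
    eq₂ = solve-∀ ℚ-ring

  -- Selects the upper branch of the quadratic inequality, which also holds below (3 - √5)/2. If T
  -- were less than 5/2, then 5/2 would itself be above ν; but `golden` fails at 5/2.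
  5≤2T : ∀ T → ν <ᴿ fromℚ T → 5ℚ * ½ ≤ T
  5≤2T T (ε , 0<ε , below) = ≮⇒≥ λ lt → from-no (3ℚ * (5ℚ * ½) ≤? (5ℚ * ½) * (5ℚ * ½) + 1ℚ)
    (golden (5ℚ * ½) (ε , 0<ε , ((λ h → ≤-trans h (<⇒≤ lt)) <$> below)))

  1≤ν : Eventually (λ n → 1ℚ ≤ seq ν n)
  1≤ν = N , λ n le → 0≤q-p⇒p≤q (subst (0ℚ ≤_) (eq (seq ν n) (seq ν N))
      (0≤+ (p≤q⇒0≤q-p (5≤2T (seq ν N + 1ℚ) (½ , 0<½ , N , λ m le′ → 0≤q-p⇒p≤q (subst (0ℚ ≤_) (eq₂ (seq ν m) (seq ν N))
        (p≤q⇒0≤q-p (≤-trans (p≤∣p∣ (seq ν m - seq ν N)) (<⇒≤ (close m N le′ ℕ.≤-refl))))))))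
        (p≤q⇒0≤q-p (≤-trans (p≤∣p∣ (seq ν N - seq ν n)) (<⇒≤ (close N n ℕ.≤-refl le))))))
    where
    0<½ : 0ℚ < ½
    0<½ = from-yes (0ℚ <? ½)
    N : ℕ
    N = proj₁ (cauchy ν ½ 0<½)
    close : ∀ m n → N ℕ.≤ m → N ℕ.≤ n → ∣ seq ν m - seq ν n ∣ < ½
    close = proj₂ (cauchy ν ½ 0<½)
    eq : ∀ v s → (s + 1ℚ - 5ℚ * ½) + (½ - (s - v)) ≡ v - 1ℚ
    eq = solve-∀ ℚ-ring
    eq₂ : ∀ v s → ½ - (v - s) ≡ s + 1ℚ - (v + ½)
    eq₂ = solve-∀ ℚ-ring

  -- The two inequalities for T = A/b with the denominator cleared, ready to be read as inequalities
  -- between natural numbers.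
  golden-multiple : ∀ A b → 0 ℕ.< b → ∀ {ε} → 0ℚ < ε →
    Eventually (λ n → fromℕ b * seq ν n + ε ≤ A) →
    3ℚ * (A * fromℕ b) ≤ A * A + fromℕ b * fromℕ b × 5ℚ * fromℕ b ≤ 2ℚ * A
  golden-multiple A b 0<b {ε} 0<ε below =
      subst (λ A → 3ℚ * (A * B) ≤ A * A + B * B) TB≡A (0≤q-p⇒p≤q (subst (0ℚ ≤_) (eq₁ T B)
        (0≤* (p≤q⇒0≤q-p (golden T ν<T)) (0≤* (0≤fromℕ b) (0≤fromℕ b)))))
    , subst (λ A → 5ℚ * B ≤ 2ℚ * A) TB≡A (0≤q-p⇒p≤q (subst (0ℚ ≤_) (eq₂ T B)
        (0≤* (0≤* {2ℚ} (from-yes (0ℚ ≤? 2ℚ)) (p≤q⇒0≤q-p (5≤2T T ν<T))) (0≤fromℕ b))))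
    where
    B i T : ℚ
    B = fromℕ b
    i = inv B
    T = A * i
    assoc : ∀ A i B → A * i * B ≡ A * B * i
    assoc = solve-∀ ℚ-ring
    TB≡A : T * B ≡ A
    TB≡A = trans (assoc A i B) (inv-cancel {b} A 0<b)
    eq₁ : ∀ T B → (T * T + 1ℚ - 3ℚ * T) * (B * B) ≡ (T * B) * (T * B) + B * B - 3ℚ * ((T * B) * B)
    eq₁ = solve-∀ ℚ-ring
    eq₂ : ∀ T B → 2ℚ * (T - 5ℚ * ½) * B ≡ 2ℚ * (T * B) - 5ℚ * B
    eq₂ = solve-∀ ℚ-ring
    eq₃ : ∀ B v ε i → (B * v + ε) * i ≡ v * B * i + ε * i
    eq₃ = solve-∀ ℚ-ring
    ν<T : ν <ᴿ fromℚ T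
    ν<T = ε * i , 0<* 0<ε (0<inv 0<b) , ((λ {n} h → subst (_≤ T)
      (trans (eq₃ B (seq ν n) ε i) (cong (_+ ε * i) (inv-cancel {b} (seq ν n) 0<b)))
      (*-monoˡ i (<⇒≤ (0<inv 0<b)) h)) <$> below)

  -- Finds a natural number `f` close to j ν. It is the floor of an expression in one rational term
  -- of ν, so no comparison with the real number ν has to be decided.
  module Approximation (j : ℕ) where

    precision : ℚ
    precision = inv (fromℕ (4 ℕ.* suc j))

    0<precision : 0ℚ < precision
    0<precision = 0<inv {4 ℕ.* suc j} (s≤s z≤n)

    4[1+j]*precision : 4ℚ * (1ℚ + fromℕ j) * precision ≡ 1ℚ
    4[1+j]*precision = trans (*-comm (4ℚ * (1ℚ + fromℕ j)) precision)
      (trans (cong (precision *_) (sym (trans (fromℕ-* 4 (suc j)) (cong (4ℚ *_) (fromℕ-+ 1 j)))))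
        (inv-* {4 ℕ.* suc j} (s≤s z≤n)))

    index : ℕ
    index = proj₁ (cauchy ν precision 0<precision)

    s : ℚ
    s = seq ν index

    ν-s : Eventually (λ n → seq ν n ≤ s + precision)
    ν-s = index , λ n le → 0≤q-p⇒p≤q (subst (0ℚ ≤_) (eq (seq ν n) s precision)
      (p≤q⇒0≤q-p (≤-trans (p≤∣p∣ (seq ν n - s)) (<⇒≤ (proj₂ (cauchy ν precision 0<precision) n index le ℕ.≤-refl)))))
      where
      eq : ∀ v s ε → ε - (v - s) ≡ s + ε - v
      eq = solve-∀ ℚ-ring

    s-ν : Eventually (λ n → s ≤ seq ν n + precision)
    s-ν = index , λ n le → 0≤q-p⇒p≤q (subst (0ℚ ≤_) (eq (seq ν n) s precision)
      (p≤q⇒0≤q-p (≤-trans (p≤∣p∣ (s - seq ν n)) (<⇒≤ (proj₂ (cauchy ν precision 0<precision) index n ℕ.≤-refl le)))))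
      where
      eq : ∀ v s ε → ε - (s - v) ≡ v + ε - s
      eq = solve-∀ ℚ-ring

    j*precision≤¼ : fromℕ j * precision ≤ ¼
    j*precision≤¼ = 0≤q-p⇒p≤q (subst (0ℚ ≤_)
      (trans (eq (fromℕ j) precision) (cong (λ t → ¼ * t - fromℕ j * precision) 4[1+j]*precision))
      (<⇒≤ 0<precision))
      where
      eq : ∀ j ε → ε ≡ ¼ * (4ℚ * (1ℚ + j) * ε) - j * ε
      eq = solve-∀ ℚ-ring

    precision≤¼ : precision ≤ ¼
    precision≤¼ = 0≤q-p⇒p≤q (subst (0ℚ ≤_)
      (trans (eq (fromℕ j) precision) (cong (λ t → ¼ * t - precision) 4[1+j]*precision))
      (0≤* (0≤fromℕ j) (<⇒≤ 0<precision)))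
      where
      eq : ∀ j ε → j * ε ≡ ¼ * (4ℚ * (1ℚ + j) * ε) - ε
      eq = solve-∀ ℚ-ring

    0≤s : 0ℚ ≤ s
    0≤s = ≤-trans (from-yes (0ℚ ≤? 5ℚ * ½ - 2ℚ * ¼)) (0≤q-p⇒p≤q (subst (0ℚ ≤_) (eq s precision)
      (0≤+ (p≤q⇒0≤q-p (5≤2T (s + 2ℚ * precision) (precision , 0<precision , ((λ {n} h →
        subst (seq ν n + precision ≤_) (eq₂ s precision) (+-monoˡ-≤ precision h)) <$> ν-s))))
        (0≤* {2ℚ} (from-yes (0ℚ ≤? 2ℚ)) (p≤q⇒0≤q-p precision≤¼)))))
      where
      eq : ∀ s ε → (s + 2ℚ * ε - 5ℚ * ½) + 2ℚ * (¼ - ε) ≡ s - (5ℚ * ½ - 2ℚ * ¼)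
      eq = solve-∀ ℚ-ring
      eq₂ : ∀ s ε → s + ε + ε ≡ s + 2ℚ * ε
      eq₂ = solve-∀ ℚ-ring

    target : ℚ
    -- Replacing j ν by `fromℕ j * s` costs at most 1/4. The shift 1/2 therefore leaves f + 1 at
    -- least 1/4 above j ν, the strict margin that `golden-multiple` asks for.
    target = fromℕ j * s + ½

    0≤target : 0ℚ ≤ target
    0≤target = 0≤+ (0≤* (0≤fromℕ j) 0≤s) (from-yes (0ℚ ≤? ½))

    f : ℕ
    f = ⌊ target ⌋ℕ

    f-lower : Eventually (λ n → fromℕ j * seq ν n + ¼ ≤ 1ℚ + fromℕ f)
    f-lower = (λ {n} h → 0≤q-p⇒p≤q (subst (0ℚ ≤_) (eq (fromℕ j) (seq ν n) s precision (fromℕ f))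
      (0≤+ (0≤+ (0≤* (0≤fromℕ j) (p≤q⇒0≤q-p h)) (p≤q⇒0≤q-p j*precision≤¼))
        (p≤q⇒0≤q-p (subst (target ≤_) (fromℕ-+ 1 f) (floor-upper 0≤target)))))) <$> ν-s
      where
      eq : ∀ j v s ε f → j * (s + ε - v) + (¼ - j * ε) + (1ℚ + f - (j * s + ½)) ≡ 1ℚ + f - (j * v + ¼)
      eq = solve-∀ ℚ-ring

    f-upper : Eventually (λ n → fromℕ f ≤ fromℕ j * seq ν n + 1ℚ)
    f-upper = (λ {n} h → 0≤q-p⇒p≤q (subst (0ℚ ≤_) (eq (fromℕ j) (seq ν n) s precision (fromℕ f))
      (0≤+ (0≤+ (0≤* (0≤fromℕ j) (p≤q⇒0≤q-p h)) (p≤q⇒0≤q-p j*precision≤¼))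
        (0≤+ (p≤q⇒0≤q-p (floor-lower 0≤target)) (from-yes (0ℚ ≤? ¼)))))) <$> s-ν
      where
      eq : ∀ j v s ε f → j * (v + ε - s) + (¼ - j * ε) + ((j * s + ½ - f) + ¼) ≡ j * v + 1ℚ - f
      eq = solve-∀ ℚ-ring

-- The exponents `a j` and their inequalities.

module Exponents
  (ν : ℝ) (φ²≤ν : ⟨3+√5⟩/2 ≤ᴿ ν) (f : ℕ → ℕ)
  (f-lower : ∀ j → Eventually (λ n → fromℕ j * seq ν n + ¼ ≤ 1ℚ + fromℕ (f j)))
  (f-upper : ∀ j → Eventually (λ n → fromℕ (f j) ≤ fromℕ j * seq ν n + 1ℚ))
  where

  open AboveGolden ν φ²≤ν

  -- Exceeds j ν by at least 2 + 1/4 and at most 4. `X-lower` costs one unit and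
  -- `good-approximation` another; the remaining `suc (f j)` is still above j ν.
  a : ℕ → ℕ
  a j = 3 ℕ.+ f j

  fromℕ-a : ∀ j → fromℕ (a j) ≡ 3ℚ + fromℕ (f j)
  fromℕ-a j = fromℕ-+ 3 (f j)

  -- For j ≥ 1 every summand is nonnegative, with g standing for a (suc j) - 2;
  -- the right-hand side is 2 (j + 1) times the difference of the sides of slack.
  slack-identity : ∀ j a g →
    2ℚ * j * (g * g + (1ℚ + j) * (1ℚ + j) - 3ℚ * (g * (1ℚ + j)))
      + 2ℚ * j * (2ℚ * g - 5ℚ * (1ℚ + j))
      + (a * (1ℚ + j) - j * g) * (2ℚ * g - 5ℚ * (1ℚ + j))
      + (j * g + 4ℚ * (1ℚ + j) - a * (1ℚ + j)) * (1ℚ + j)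
      + 4ℚ * (a * (1ℚ + j) - j * g)
      + 2ℚ * 3ℚ * (1ℚ + j) * (j - 1ℚ)
    ≡ (a * (2ℚ + g) + j * (1ℚ + j)) * (2ℚ * (1ℚ + j)) - (3ℚ * a * (1ℚ + j) + 1ℚ) * (2ℚ * (1ℚ + j))
  slack-identity = solve-∀ ℚ-ring

  fromℕ-suc : ∀ j → fromℕ (suc j) ≡ 1ℚ + fromℕ j
  fromℕ-suc j = fromℕ-+ 1 j

  -- Divided by `a j * suc j`, for j ≥ 1 this is R′ + 1/R ≥ 3 with a little room, where R and R′ are
  -- the exponents `a j / j` and `a (suc j) / suc j`. As ν + 1/ν ≥ 3, it holds because R′ exceeds ν
  -- by more than 2/(j + 1), whereas 1/R falls short of 1/ν by at most 4/(ν² j), and ν > 5/2.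
  slack : ∀ j → 3 ℕ.* a j ℕ.* suc j ℕ.+ 1 ℕ.≤ a j ℕ.* a (suc j) ℕ.+ j ℕ.* suc j
  -- For j = 0 the claim reduces to `a 1` being at least 4.
  slack zero = ℕ.≤-trans (ℕ.+-monoʳ-≤ (3 ℕ.* a 0 ℕ.* 1) (s≤s z≤n)) (ℕ.≤-trans (ℕ.≤-reflexive (eq (a 0)))
    (ℕ.≤-trans (ℕ.*-monoʳ-≤ (a 0) (ℕ.+-monoʳ-≤ 3 1≤f)) (ℕ.m≤m+n _ 0)))
    where
    eq : ∀ a → 3 ℕ.* a ℕ.* 1 ℕ.+ a ≡ a ℕ.* 4
    eq = ℕ-Solver.solve-∀
    large : 5ℚ * fromℕ 1 ≤ 2ℚ * (1ℚ + fromℕ (f 1))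
    large = proj₂ (golden-multiple (1ℚ + fromℕ (f 1)) 1 (s≤s z≤n) (from-yes (0ℚ <? ¼)) (f-lower 1))
    1≤f : 1 ℕ.≤ f 1
    1≤f = ℕ.n≢0⇒n>0 λ f≡0 → from-no (5ℚ * fromℕ 1 ≤? 2ℚ * (1ℚ + fromℕ 0))
      (subst (λ k → 5ℚ * fromℕ 1 ≤ 2ℚ * (1ℚ + fromℕ k)) f≡0 large)
  slack (suc k) = fromℕ-cancel-≤ {3 ℕ.* a j ℕ.* suc j ℕ.+ 1} {a j ℕ.* a (suc j) ℕ.+ j ℕ.* suc j}
    (subst₂ _≤_ (sym lhs) (sym rhs) (*-cancelʳ (3ℚ * A * (1ℚ + K) + 1ℚ) (A * (2ℚ + G) + K * (1ℚ + K)) 0<2[1+j]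
      (0≤q-p⇒p≤q (subst (0ℚ ≤_) (slack-identity K A G) nonneg))))
    where
    j : ℕ
    j = suc k
    K A F G F′ : ℚ
    K  = fromℕ j
    A  = fromℕ (a j)
    F  = fromℕ (f j)
    F′ = fromℕ (f (suc j))
    G  = 1ℚ + F′
    0<2[1+j] : 0ℚ < 2ℚ * (1ℚ + K)
    0<2[1+j] = 0<* (from-yes (0ℚ <? 2ℚ)) (subst (0ℚ <_) (fromℕ-suc j) (fromℕ-mono-< {0} {suc j} (s≤s z≤n)))
    0≤2 : 0ℚ ≤ 2ℚ
    0≤2 = from-yes (0ℚ ≤? 2ℚ)
    0≤K : 0ℚ ≤ K
    0≤K = 0≤fromℕ j
    0≤1+K : 0ℚ ≤ 1ℚ + K
    0≤1+K = 0≤+ (<⇒≤ 0<1) 0≤K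
    lhs : fromℕ (3 ℕ.* a j ℕ.* suc j ℕ.+ 1) ≡ 3ℚ * A * (1ℚ + K) + 1ℚ
    lhs = trans (fromℕ-+ (3 ℕ.* a j ℕ.* suc j) 1) (cong (_+ 1ℚ) (trans (fromℕ-* (3 ℕ.* a j) (suc j))
      (cong₂ _*_ (fromℕ-* 3 (a j)) (fromℕ-suc j))))
    rhs : fromℕ (a j ℕ.* a (suc j) ℕ.+ j ℕ.* suc j) ≡ A * (2ℚ + G) + K * (1ℚ + K)
    rhs = trans (fromℕ-+ (a j ℕ.* a (suc j)) (j ℕ.* suc j)) (cong₂ _+_
      (trans (fromℕ-* (a j) (a (suc j))) (cong (A *_) (trans (fromℕ-a (suc j)) (+-assoc 2ℚ 1ℚ F′))))
      (trans (fromℕ-* j (suc j)) (cong (K *_) (fromℕ-suc j))))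
    multiple : 3ℚ * (G * (1ℚ + K)) ≤ G * G + (1ℚ + K) * (1ℚ + K) × 5ℚ * (1ℚ + K) ≤ 2ℚ * G
    multiple = subst (λ B → 3ℚ * (G * B) ≤ G * G + B * B × 5ℚ * B ≤ 2ℚ * G) (fromℕ-suc j)
      (golden-multiple G (suc j) (s≤s z≤n) (from-yes (0ℚ <? ¼)) (f-lower (suc j)))
    E₁ : 0ℚ ≤ G * G + (1ℚ + K) * (1ℚ + K) - 3ℚ * (G * (1ℚ + K))
    E₁ = p≤q⇒0≤q-p (proj₁ multiple)
    E₂ : 0ℚ ≤ 2ℚ * G - 5ℚ * (1ℚ + K)
    E₂ = p≤q⇒0≤q-p (proj₂ multiple)
    -- A late term of ν is eliminated between the bounds on `f j` and `f (suc j)`. Together with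
    -- `E₃` this says that `A` exceeds `K * G / (1 + K)` by between 0 and 4.
    W : 0ℚ ≤ A * (1ℚ + K) - K * G
    W = proj₂ (sometime ((λ {n} below above →
      subst (0ℚ ≤_) (trans (eq K F F′ (seq ν n)) (cong (λ t → t * (1ℚ + K) - K * G) (sym (fromℕ-a j))))
        (0≤+ (0≤+ (0≤* (p≤q⇒0≤q-p below) 0≤1+K)
          (0≤* 0≤K (p≤q⇒0≤q-p (subst (λ t → F′ ≤ t * seq ν n + 1ℚ) (fromℕ-suc j) above))))
          (0≤+ (0≤* (from-yes (0ℚ ≤? ¼)) 0≤1+K) 0≤2))) <$> f-lower j <*> f-upper (suc j)))
      where
      eq : ∀ j f f′ v → (1ℚ + f - (j * v + ¼)) * (1ℚ + j) + j * ((1ℚ + j) * v + 1ℚ - f′) + (¼ * (1ℚ + j) + 2ℚ)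
        ≡ (3ℚ + f) * (1ℚ + j) - j * (1ℚ + f′)
      eq = solve-∀ ℚ-ring
    E₃ : 0ℚ ≤ K * G + 4ℚ * (1ℚ + K) - A * (1ℚ + K)
    E₃ = proj₂ (sometime ((λ {n} above below →
      subst (0ℚ ≤_) (trans (eq K F F′ (seq ν n)) (cong (λ t → K * G + 4ℚ * (1ℚ + K) - t * (1ℚ + K)) (sym (fromℕ-a j))))
        (0≤+ (0≤+ (0≤* (p≤q⇒0≤q-p above) 0≤1+K)
          (0≤* 0≤K (p≤q⇒0≤q-p (subst (λ t → t * seq ν n + ¼ ≤ G) (fromℕ-suc j) below))))
          (0≤* 0≤K (from-yes (0ℚ ≤? ¼))))) <$> f-upper j <*> f-lower (suc j)))
      where
      eq : ∀ j f f′ v → (j * v + 1ℚ - f) * (1ℚ + j) + j * (1ℚ + f′ - ((1ℚ + j) * v + ¼)) + j * ¼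
        ≡ j * (1ℚ + f′) + 4ℚ * (1ℚ + j) - (3ℚ + f) * (1ℚ + j)
      eq = solve-∀ ℚ-ring
    K-1 : 0ℚ ≤ K - 1ℚ
    K-1 = p≤q⇒0≤q-p (fromℕ-mono-≤ {1} {j} (s≤s z≤n))
    nonneg = 0≤+ (0≤+ (0≤+ (0≤+ (0≤+ (0≤* (0≤* 0≤2 0≤K) E₁) (0≤* (0≤* 0≤2 0≤K) E₂)) (0≤* W E₂)) (0≤* E₃ 0≤1+K))
      (0≤* {4ℚ} (from-yes (0ℚ ≤? 4ℚ)) W)) (0≤* (0≤* {2ℚ * 3ℚ} (from-yes (0ℚ ≤? 2ℚ * 3ℚ)) 0≤1+K) K-1)

  M : ℕ
  M = bound ν ℕ.+ 4

  a≤M : ∀ j → a j ℕ.≤ M ℕ.* suc j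
  a≤M j = fromℕ-cancel-≤ {a j} {M ℕ.* suc j} (proj₂ (sometime ((λ {n} above ν≤ → 0≤q-p⇒p≤q
    (subst (0ℚ ≤_) (trans (eq (fromℕ j) (fromℕ (f j)) (seq ν n) (fromℕ (bound ν)))
        (cong₂ _-_ (sym rhs) (sym (fromℕ-a j))))
      (0≤+ (0≤+ (p≤q⇒0≤q-p above) (0≤* (0≤fromℕ j) (p≤q⇒0≤q-p ν≤)))
        (0≤+ (0≤fromℕ (bound ν)) (0≤* {4ℚ} (from-yes (0ℚ ≤? 4ℚ)) (0≤fromℕ j))))))
    <$> f-upper j <*> ≤bound ν)))
    where
    eq : ∀ j f v b → (j * v + 1ℚ - f) + j * (b - v) + (b + 4ℚ * j) ≡ (b + 4ℚ) * (1ℚ + j) - (3ℚ + f)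
    eq = solve-∀ ℚ-ring
    rhs : fromℕ (M ℕ.* suc j) ≡ (fromℕ (bound ν) + 4ℚ) * (1ℚ + fromℕ j)
    rhs = trans (fromℕ-* M (suc j)) (cong₂ _*_ (fromℕ-+ (bound ν) 4) (fromℕ-suc j))

  -- Provides the hypotheses of `golden-power` with A = `a j` - 1 and B = `j`: substituting A = B +
  -- C turns 3AB ≤ A² + B² into BA ≤ C².
  golden-split : ∀ j → 0 ℕ.< j → ∃ λ C → 2 ℕ.+ f j ≡ j ℕ.+ C × j ℕ.* (2 ℕ.+ f j) ℕ.≤ C ℕ.* C
  golden-split j 0<j = C , A≡j+C , le
    where
    A C : ℕ
    A = 2 ℕ.+ f j
    C = A ℕ.∸ j
    multiple : 3ℚ * (fromℕ A * fromℕ j) ≤ fromℕ A * fromℕ A + fromℕ j * fromℕ j × 5ℚ * fromℕ j ≤ 2ℚ * fromℕ A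
    multiple = golden-multiple (fromℕ A) j 0<j (from-yes (0ℚ <? ¼))
      ((λ h → ≤-trans h (subst (1ℚ + fromℕ (f j) ≤_) (sym (fromℕ-+ 2 (f j)))
        (+-monoˡ-≤ (fromℕ (f j)) (from-yes (1ℚ ≤? 2ℚ))))) <$> f-lower j)
    j≤A : j ℕ.≤ A
    j≤A = ℕ.*-cancelˡ-≤ 2 (ℕ.≤-trans (ℕ.*-monoˡ-≤ j (ℕ.m≤m+n 2 3))
      (fromℕ-cancel-≤ {5 ℕ.* j} {2 ℕ.* A} (≤-trans (≤-reflexive (fromℕ-* 5 j)) (≤-trans (proj₂ multiple) (≤-reflexive (sym (fromℕ-* 2 A)))))))
    A≡j+C : A ≡ j ℕ.+ C
    A≡j+C = sym (ℕ.m+[n∸m]≡n j≤A)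
    3Aj≤ : 3 ℕ.* (A ℕ.* j) ℕ.≤ A ℕ.* A ℕ.+ j ℕ.* j
    3Aj≤ = fromℕ-cancel-≤ {3 ℕ.* (A ℕ.* j)} {A ℕ.* A ℕ.+ j ℕ.* j} (subst₂ _≤_
      (sym (trans (fromℕ-* 3 (A ℕ.* j)) (cong (3ℚ *_) (fromℕ-* A j))))
      (sym (trans (fromℕ-+ (A ℕ.* A) (j ℕ.* j)) (cong₂ _+_ (fromℕ-* A A) (fromℕ-* j j))))
      (proj₁ multiple))
    le : j ℕ.* A ℕ.≤ C ℕ.* C
    le = ℕ.+-cancelˡ-≤ (2 ℕ.* j ℕ.* (j ℕ.+ C)) _ _ (begin
      2 ℕ.* j ℕ.* (j ℕ.+ C) ℕ.+ j ℕ.* A             ≡⟨ cong (λ t → 2 ℕ.* j ℕ.* (j ℕ.+ C) ℕ.+ j ℕ.* t) A≡j+C ⟩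
      2 ℕ.* j ℕ.* (j ℕ.+ C) ℕ.+ j ℕ.* (j ℕ.+ C)     ≡⟨ eq₁ j C ⟩
      3 ℕ.* ((j ℕ.+ C) ℕ.* j)                       ≡⟨ cong (λ t → 3 ℕ.* (t ℕ.* j)) A≡j+C ⟨
      3 ℕ.* (A ℕ.* j)                               ≤⟨ 3Aj≤ ⟩
      A ℕ.* A ℕ.+ j ℕ.* j                           ≡⟨ cong (λ t → t ℕ.* t ℕ.+ j ℕ.* j) A≡j+C ⟩
      (j ℕ.+ C) ℕ.* (j ℕ.+ C) ℕ.+ j ℕ.* j           ≡⟨ eq₂ j C ⟩
      2 ℕ.* j ℕ.* (j ℕ.+ C) ℕ.+ C ℕ.* C             ∎)
      where
      open ℕ.≤-Reasoning
      eq₁ : ∀ j C → 2 ℕ.* j ℕ.* (j ℕ.+ C) ℕ.+ j ℕ.* (j ℕ.+ C) ≡ 3 ℕ.* ((j ℕ.+ C) ℕ.* j)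
      eq₁ = ℕ-Solver.solve-∀
      eq₂ : ∀ j C → (j ℕ.+ C) ℕ.* (j ℕ.+ C) ℕ.+ j ℕ.* j ≡ 2 ℕ.* j ℕ.* (j ℕ.+ C) ℕ.+ C ℕ.* C
      eq₂ = ℕ-Solver.solve-∀

-- The irrationality exponent

∑<-cong : ∀ {f g : ℕ → ℚ} → (∀ k → f k ≡ g k) → ∀ N → ∑< N f ≡ ∑< N g
∑<-cong f≡g zero    = refl
∑<-cong f≡g (suc N) = cong₂ _+_ (∑<-cong f≡g N) (f≡g N)

0<^ : ∀ {p} n → 0ℚ < p → 0ℚ < p ^ n
0<^ zero    _   = 0<1
0<^ (suc n) 0<p = 0<* 0<p (0<^ n 0<p)

large-denominator : ∀ rs → ∃ λ k → ∀ r → k ℕ.< ↧ₙ r → All (r ≢_) rs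
large-denominator []       = 0 , λ _ _ → []
large-denominator (s ∷ rs) =
  let k , h = large-denominator rs
  in ↧ₙ s ℕ.⊔ k , λ r lt →
       (λ r≡s → ℕ.<⇒≢ (ℕ.m⊔n<o⇒m<o (↧ₙ s) k lt) (cong ↧ₙ_ (sym r≡s)))
     ∷ h r (ℕ.m⊔n<o⇒n<o (↧ₙ s) k lt)

fractions : ℕ → ℕ → List ℚ
fractions L D = cartesianProductWith (λ n d → + n / suc d) (upTo (suc L)) (upTo D)

∈-fractions : ∀ {r L D} → 0ℚ ≤ r → r * fromℕ (↧ₙ r) ≤ fromℕ L → ↧ₙ r ℕ.≤ D → r ∈ fractions L D
∈-fractions {r@(mkℚ (+ n) d _)} {L} {D} _ num≤L den≤D = subst (_∈ fractions L D) (↥p/↧p≡p r)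
  (∈-cartesianProductWith⁺ (λ n d → + n / suc d)
    (∈-upTo⁺ (s≤s (fromℕ-cancel-≤ {n} {L} (subst (_≤ fromℕ L) (*-↧ₙ r) num≤L)))) (∈-upTo⁺ den≤D))
∈-fractions {r@(mkℚ -[1+ n ] d _)} 0≤r _ _ = contradiction 0≤r (<⇒≱ (negative⁻¹ r))

^ᶻ-nonNeg : ∀ p {r} → 0ℚ ≤ r → p ^ᶻ ↥ r ≡ p ^ ℤ.∣ ↥ r ∣
^ᶻ-nonNeg p {mkℚ (+ n)    d _} _   = refl
^ᶻ-nonNeg p {r@(mkℚ -[1+ n ] d _)} 0≤r = contradiction 0≤r (<⇒≱ (negative⁻¹ r))

≤-cross : ∀ {r} j a → 0ℚ ≤ r → fromℕ j * r ≤ fromℕ a → ℤ.∣ ↥ r ∣ ℕ.* j ℕ.≤ a ℕ.* ↧ₙ r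
≤-cross {r@(mkℚ (+ n)    d _)} j a _   le = fromℕ-cancel-≤ {n ℕ.* j} {a ℕ.* suc d} (begin
  fromℕ (n ℕ.* j)                ≡⟨ trans (cong fromℕ (ℕ.*-comm n j)) (fromℕ-* j n) ⟩
  fromℕ j * fromℕ n              ≡⟨ cong (fromℕ j *_) (*-↧ₙ r) ⟨
  fromℕ j * (r * fromℕ (suc d))  ≡⟨ *-assoc (fromℕ j) r (fromℕ (suc d)) ⟨
  fromℕ j * r * fromℕ (suc d)    ≤⟨ *-monoˡ (fromℕ (suc d)) (0≤fromℕ (suc d)) le ⟩
  fromℕ a * fromℕ (suc d)        ≡⟨ fromℕ-* a (suc d) ⟨
  fromℕ (a ℕ.* suc d)            ∎)
  where open ≤-Reasoning
≤-cross {r@(mkℚ -[1+ n ] d _)} _ _ 0≤r _ = contradiction 0≤r (<⇒≱ (negative⁻¹ r))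

≥-cross : ∀ {r} j a → 0ℚ ≤ r → fromℕ a ≤ fromℕ j * r → a ℕ.* ↧ₙ r ℕ.≤ ℤ.∣ ↥ r ∣ ℕ.* j
≥-cross {r@(mkℚ (+ n)    d _)} j a _   le = fromℕ-cancel-≤ {a ℕ.* suc d} {n ℕ.* j} (begin
  fromℕ (a ℕ.* suc d)            ≡⟨ fromℕ-* a (suc d) ⟩
  fromℕ a * fromℕ (suc d)        ≤⟨ *-monoˡ (fromℕ (suc d)) (0≤fromℕ (suc d)) le ⟩
  fromℕ j * r * fromℕ (suc d)    ≡⟨ *-assoc (fromℕ j) r (fromℕ (suc d)) ⟩
  fromℕ j * (r * fromℕ (suc d))  ≡⟨ cong (fromℕ j *_) (*-↧ₙ r) ⟩
  fromℕ j * fromℕ n              ≡⟨ trans (cong fromℕ (ℕ.*-comm n j)) (fromℕ-* j n) ⟨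
  fromℕ (n ℕ.* j)                ∎)
  where open ≤-Reasoning
≥-cross {r@(mkℚ -[1+ n ] d _)} _ _ 0≤r _ = contradiction 0≤r (<⇒≱ (negative⁻¹ r))

^-≤-self : ∀ {p} n → 0 ℕ.< n → 0ℚ ≤ p → p ≤ 1ℚ → p ^ n ≤ p
^-≤-self {p} (suc n) _ 0≤p p≤1 = begin
  p * p ^ n    ≤⟨ *-monoʳ p 0≤p (^-mono-≤ n 0≤p p≤1) ⟩
  p * 1ℚ ^ n   ≡⟨ cong (p *_) (1^ n) ⟩
  p * 1ℚ       ≡⟨ *-identityʳ p ⟩
  p            ∎
  where open ≤-Reasoning

-- t ≥ 1/z ≥ 1/Q^(a/l) ≥ 1/Q^(c/b)
1≤t^b*Q^c : ∀ {t z Q a l b c} → 0ℚ ≤ t → 0 ℕ.< l → 0 ℕ.< Q →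
  1ℚ ≤ t * fromℕ z → z ℕ.^ l ℕ.≤ Q ℕ.^ a → a ℕ.* b ℕ.≤ c ℕ.* l →
  1ℚ ≤ t ^ b * fromℕ Q ^ c
-- Taking an `l`-th root is avoided: the `l`-th power of the product is at least 1, and a product
-- below 1 is at least as large as its own `l`-th power.
1≤t^b*Q^c {t} {z} {Q} {a} {l} {b} {c} 0≤t 0<l 0<Q 1≤tz zˡ≤Qᵃ ab≤cl = ≮⇒≥ λ p<1 → <⇒≱ p<1 (begin
  1ℚ                             ≡⟨ 1^ (b ℕ.* l) ⟨
  1ℚ ^ (b ℕ.* l)                 ≤⟨ ^-mono-≤ (b ℕ.* l) (<⇒≤ 0<1) 1≤tz ⟩
  (t * fromℕ z) ^ (b ℕ.* l)      ≡⟨ ℚ-Exp.^-distrib-* t (fromℕ z) (b ℕ.* l) ⟩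
  t ^ (b ℕ.* l) * fromℕ z ^ (b ℕ.* l)  ≡⟨ cong (t ^ (b ℕ.* l) *_) (fromℕ-^ z (b ℕ.* l)) ⟨
  t ^ (b ℕ.* l) * fromℕ (z ℕ.^ (b ℕ.* l))  ≤⟨ *-monoʳ (t ^ (b ℕ.* l)) (0≤^ (b ℕ.* l) 0≤t) (fromℕ-mono-≤ {z ℕ.^ (b ℕ.* l)} {Q ℕ.^ (c ℕ.* l)} le) ⟩
  t ^ (b ℕ.* l) * fromℕ (Q ℕ.^ (c ℕ.* l))  ≡⟨ cong (t ^ (b ℕ.* l) *_) (fromℕ-^ Q (c ℕ.* l)) ⟩
  t ^ (b ℕ.* l) * fromℕ Q ^ (c ℕ.* l)  ≡⟨ cong₂ _*_ (ℚ-Exp.^-assocʳ t b l) (ℚ-Exp.^-assocʳ (fromℕ Q) c l) ⟨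
  (t ^ b) ^ l * (fromℕ Q ^ c) ^ l  ≡⟨ ℚ-Exp.^-distrib-* (t ^ b) (fromℕ Q ^ c) l ⟨
  (t ^ b * fromℕ Q ^ c) ^ l      ≤⟨ ^-≤-self l 0<l (0≤* (0≤^ b 0≤t) (0≤^ c (0≤fromℕ Q))) (<⇒≤ p<1) ⟩
  t ^ b * fromℕ Q ^ c            ∎)
  where
  open ≤-Reasoning
  le : z ℕ.^ (b ℕ.* l) ℕ.≤ Q ℕ.^ (c ℕ.* l)
  le = ℕ.≤-trans (ℕ.≤-reflexive (trans (cong (z ℕ.^_) (ℕ.*-comm b l)) (sym (ℕ.^-*-assoc z l b))))
    (ℕ.≤-trans (ℕ.^-monoˡ-≤ b zˡ≤Qᵃ)
    (ℕ.≤-trans (ℕ.≤-reflexive (ℕ.^-*-assoc Q a b)) (ℕ.^-monoʳ-≤ Q {{ℕ.>-nonZero 0<Q}} ab≤cl)))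

-- The number α and its irrationality exponent.

module Number
  (ν : ℝ) (φ²≤ν : ⟨3+√5⟩/2 ≤ᴿ ν) (f : ℕ → ℕ)
  (f-lower : ∀ j → Eventually (λ n → fromℕ j * seq ν n + ¼ ≤ 1ℚ + fromℕ (f j)))
  (f-upper : ∀ j → Eventually (λ n → fromℕ (f j) ≤ fromℕ j * seq ν n + 1ℚ))
  (i : ℕ) (0<i : 0 ℕ.< i)
  where

  open AboveGolden ν φ²≤ν using (1≤ν)
  open Exponents ν φ²≤ν f f-lower f-upper
  open Construction a M (λ _ → s≤s z≤n) (ℕ.≤-trans (s≤s z≤n) (ℕ.m≤n+m 4 (bound ν))) a≤M slack

  Y∣Y : ∀ j → Y (suc j) ∣ Y (suc (suc j))
  Y∣Y j = m∣m*n (1 ℕ.+ u (suc j) ℕ.* X (suc j))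

  open Series i X Y refl (λ _ → refl) Y∣Y 0<X X<Y

  -- The greedy construction defines `u` by recursion together with the state; the defining
  -- recurrence, run on the finished sequence `u`, retraces that state.
  xy≡state : ∀ j → xy 1 1 u j ≡ state j
  xy≡state zero    = refl
  xy≡state (suc j) = cong
    (λ (x , y) → x ℕ.* (y ℕ.* (1 ℕ.+ u j ℕ.* x)) , y ℕ.* (1 ℕ.+ u j ℕ.* x)) (xy≡state j)

  S-⟶ : ∀ {s} → (∀ N → s N ≡ S N) → s ⟶ α
  S-⟶ {s} s≡S ε 0<ε =
    let j , small = tail-small (0<½* 0<ε)
    in j , λ n j≤n → ½ * ε , 0<½* 0<ε , j , λ m j≤m → (begin
      ∣ s n - S m ∣ + ½ * ε          ≡⟨ cong (λ p → ∣ p - S m ∣ + ½ * ε) (s≡S n) ⟩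
      ∣ S n - S m ∣ + ½ * ε          ≤⟨ +-monoˡ-≤ (½ * ε) (≤-trans (S-close j≤n j≤m) (<⇒≤ small)) ⟩
      ½ * ε + ½ * ε                  ≡⟨ eq ε ⟩
      ε                              ∎)
    where
    open ≤-Reasoning
    eq : ∀ ε → ½ * ε + ½ * ε ≡ ε
    eq = solve-∀ ℚ-ring

  number : ℝ
  number = α

  modifiedEngel : ModifiedEngel number
  modifiedEngel = 0 , record
    { p/q = integer i ; a₀ = + i ; a = [] ; a-pos = Vec.[] ; expansion = integer≡fromℕ i
    ; m = 0 ; u = u ; u-pos = 0<u }
    , S-⟶ λ N → cong (λ t → integer i + t) (∑<-cong (λ k → cong (inv ∘ fromℕ ∘ proj₁) (xy≡state (suc k))) N)

  tail-* : ∀ j → tail j * fromℕ (X (suc j)) ≡ 1ℚ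
  tail-* j = inv-* (0<X (suc j))

  tail≤∣S-S∣ : ∀ {j n} → j ℕ.< n → tail j ≤ ∣ S n - S j ∣
  tail≤∣S-S∣ {j} {n} j<n = ≤-trans (0≤q-p⇒p≤q (subst (0ℚ ≤_) (eq (S n) (S j) (tail j)) (p≤q⇒0≤q-p (S-lower j<n))))
    (p≤∣p∣ (S n - S j))
    where
    eq : ∀ x y t → x - (y + t) ≡ x - y - t
    eq = solve-∀ ℚ-ring

  -- Lower bound: the partial sums realise every exponent below ν.

  module _ {r : ℚ} (0≤r : 0ℚ ≤ r) (r<ν : fromℚ r <ᴿ ν) where

    private
      b c : ℕ
      b = ↧ₙ r
      c = ℤ.∣ ↥ r ∣

    exponent-below : ∀ j → c ℕ.* j ℕ.≤ suc (f j) ℕ.* b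
    exponent-below j =
      let ε , 0<ε , below = r<ν
      in ≤-cross {r} j (suc (f j)) 0≤r (proj₂ (sometime ((λ {n} low le → 0≤q-p⇒p≤q (subst (0ℚ ≤_)
        (trans (eq (fromℕ j) (fromℕ (f j)) (seq ν n) r ε) (cong (_- fromℕ j * r) (sym (fromℕ-+ 1 (f j)))))
        (0≤+ (0≤+ (p≤q⇒0≤q-p low) (0≤* (0≤fromℕ j) (p≤q⇒0≤q-p le)))
          (0≤+ (from-yes (0ℚ ≤? ¼)) (0≤* (0≤fromℕ j) (<⇒≤ 0<ε))))))
        <$> f-lower j <*> below)))
      where
      eq : ∀ j f v r ε → (1ℚ + f - (j * v + ¼)) + j * (v - (r + ε)) + (¼ + j * ε) ≡ 1ℚ + f - j * r
      eq = solve-∀ ℚ-ring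

    -- With r = c/b, this places three tails below 1/X^r, X being the denominator of the partial
    -- sum. The condition on `k` makes `X (suc k)` at least `4 ^ (b * suc k)`, as
    -- `good-approximation` requires.
    S-approximates : ∀ k → 2 ℕ.* b ℕ.≤ k → (3ℚ * tail (suc k)) ^ b * fromℕ (X (suc k)) ^ c < 1ℚ
    S-approximates k 2b≤k = begin-strict
      (3ℚ * τ) ^ b * x ^ c                        ≡⟨ cong (_* x ^ c) (ℚ-Exp.^-distrib-* 3ℚ τ b) ⟩
      3ℚ ^ b * τ ^ b * x ^ c                      ≡⟨ eq (3ℚ ^ b) (τ ^ b) (x ^ c) ⟩
      3ℚ ^ b * x ^ c * τ ^ b                      ≡⟨ cong (_* τ ^ b) (trans (fromℕ-* (3 ℕ.^ b) (X j ℕ.^ c)) (cong₂ _*_ (fromℕ-^ 3 b) (fromℕ-^ (X j) c))) ⟨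
      fromℕ (3 ℕ.^ b ℕ.* X j ℕ.^ c) * τ ^ b       <⟨ *-monoˡ-<-pos (τ ^ b) {{positive (0<^ b (0<tail j))}} (fromℕ-mono-< {3 ℕ.^ b ℕ.* X j ℕ.^ c} {X (suc j) ℕ.^ b} close) ⟩
      fromℕ (X (suc j) ℕ.^ b) * τ ^ b             ≡⟨ cong (_* τ ^ b) (fromℕ-^ (X (suc j)) b) ⟩
      fromℕ (X (suc j)) ^ b * τ ^ b               ≡⟨ ℚ-Exp.^-distrib-* (fromℕ (X (suc j))) τ b ⟨
      (fromℕ (X (suc j)) * τ) ^ b                 ≡⟨ cong (_^ b) (trans (*-comm (fromℕ (X (suc j))) τ) (tail-* j)) ⟩
      1ℚ ^ b                                      ≡⟨ 1^ b ⟩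
      1ℚ                                          ∎
      where
      open ≤-Reasoning
      j : ℕ
      j = suc k
      τ x : ℚ
      τ = tail j
      x = fromℕ (X j)
      eq : ∀ p q r → p * q * r ≡ p * r * q
      eq = solve-∀ ℚ-ring
      size : 2 ℕ.* (b ℕ.* suc k) ℕ.≤ M ℕ.* ((k ℕ.+ 2) ℕ.* (k ℕ.+ 3))
      size = ℕ.≤-trans (ℕ.≤-reflexive (sym (ℕ.*-assoc 2 b (suc k))))
        (ℕ.≤-trans (ℕ.*-mono-≤ (ℕ.≤-trans 2b≤k (ℕ.m≤m+n k 2)) (ℕ.≤-trans (ℕ.≤-reflexive (ℕ.+-comm 1 k)) (ℕ.+-monoʳ-≤ k (s≤s z≤n))))
        (ℕ.≤-trans (ℕ.≤-reflexive (sym (ℕ.*-identityˡ _)))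
          (ℕ.*-monoˡ-≤ ((k ℕ.+ 2) ℕ.* (k ℕ.+ 3)) (ℕ.≤-trans (s≤s z≤n) (ℕ.m≤n+m 4 (bound ν))))))
      close : 3 ℕ.^ b ℕ.* X j ℕ.^ c ℕ.< X (suc j) ℕ.^ b
      close = good-approximation {X j} {X (suc j)} {suc (f j)} {j} {b} {c} {{X≢0 j}}
        (X-lower j) (exponent-below j)
        (ℕ.≤-trans (ℕ.≤-reflexive (ℕ.^-*-assoc 2 2 (b ℕ.* j))) (X-large k (2 ℕ.* (b ℕ.* j)) size))

    approximable : ∀ {μ} → μ <ᴿ fromℚ r → Approximable α μ
    approximable {μ} μ<r rs = S j
      , ( (tail j , 0<tail j , suc j , λ n j<n → subst (_≤ ∣ S n - S j ∣) (sym (+-identityˡ (tail j))) (tail≤∣S-S∣ j<n))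
        -- The partial sum is within two tails of α; the third makes the inequality between reals
        -- strict.
        , 3ℚ * tail j
        , (0<* {3ℚ} (from-yes (0ℚ <? 3ℚ)) (0<tail j) , r , μ<r ,
            subst (_< 1ℚ) (cong ((3ℚ * tail j) ^ b *_) (trans (sym (^ᶻ-nonNeg (fromℕ (X j)) 0≤r))
              (cong (λ Q → fromℕ Q ^ᶻ ↥ r) (sym (↧ₙ-S j)))))
              (S-approximates k (ℕ.m≤n⊔m k₀ (2 ℕ.* b))))
        , (tail j , 0<tail j , j , λ n j≤n → subst (∣ S n - S j ∣ + tail j ≤_) (eq (tail j))
            (+-monoˡ-≤ (tail j) (S-close j≤n ℕ.≤-refl))))
      , proj₂ (large-denominator rs) (S j) (subst (k₀ ℕ.<_) (sym (↧ₙ-S j)) (ℕ.≤-<-trans (ℕ.m≤m⊔n k₀ (2 ℕ.* b)) (n<X k)))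
      where
      k₀ k j : ℕ
      k₀ = proj₁ (large-denominator rs)
      k  = k₀ ℕ.⊔ 2 ℕ.* b
      j  = suc k
      eq : ∀ t → t + t + t ≡ 3ℚ * t
      eq = solve-∀ ℚ-ring

  -- Upper bound: no exponent above ν occurs.

  n≤X : ∀ n → n ℕ.≤ X n
  n≤X zero    = z≤n
  n≤X (suc n) = n<X n

  -- Says that α is at distance at least 1/z from `r`, where z ≤ Q^(a l / l) for the denominator Q
  -- of `r`. As `l` is at least `J`, a large `J` brings this exponent close to ν.
  Repelled : ℕ → ℚ → Set
  Repelled J r = ∃ λ l → ∃ λ z → J ℕ.≤ l × z ℕ.^ l ℕ.≤ ↧ₙ r ℕ.^ a l × Eventually (λ n → 1ℚ ≤ ∣ S n - r ∣ * fromℕ z)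

  -- The distance is at least the first omitted term, so `X (suc j)` serves as z, and `X-upper`
  -- bounds it.
  partial-sum-repelled : ∀ {J r} j → J ℕ.≤ j → r ≡ S j → Repelled J r
  partial-sum-repelled {J} {r} j J≤j r≡S = j , X (suc j) , J≤j
    , subst (λ Q → X (suc j) ℕ.^ j ℕ.≤ Q ℕ.^ a j) (sym (trans (cong ↧ₙ_ r≡S) (↧ₙ-S j))) (X-upper j)
    , suc j , λ n j<n → subst (λ r → 1ℚ ≤ ∣ S n - r ∣ * fromℕ (X (suc j))) (sym r≡S)
        (subst (_≤ ∣ S n - S j ∣ * fromℕ (X (suc j))) (tail-* j)
          (*-monoˡ (fromℕ (X (suc j))) (0≤fromℕ (X (suc j))) (tail≤∣S-S∣ j<n)))

  -- `r` and `S j` differ by at least 1/(Q X j). Since 4Q < `Y (suc j)`, two tails amount to at most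
  -- half of that, so at least 1/(2 Q X j) remains between `r` and α.
  other-repelled : ∀ {J r} k → J ℕ.≤ suc k →
    Y (suc (suc k)) ℕ.≤ 4 ℕ.* ↧ₙ r → 4 ℕ.* ↧ₙ r ℕ.< Y (suc (suc (suc k))) → r ≢ S (suc (suc k)) → Repelled J r
  other-repelled {J} {r} k J≤l Y≤4Q 4Q<Y r≢S = l , 2 ℕ.* Q ℕ.* X j , J≤l , power , j
    , λ n j≤n → 0≤q-p⇒p≤q (subst (0ℚ ≤_)
        (trans (combine ∣ S n - r ∣ τ q x) (cong (λ z → ∣ S n - r ∣ * z - 1ℚ) (sym 2QX)))
        (0≤+ (0≤+ (p≤q⇒0≤q-p (gap n j≤n)) (p≤q⇒0≤q-p (gap n j≤n))) (p≤q⇒0≤q-p 4QXτ≤1)))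
    where
    l j Q : ℕ
    l = suc k
    j = suc (suc k)
    Q = ↧ₙ r
    C : ℕ
    C = proj₁ (golden-split l (s≤s z≤n))
    -- The exponent belongs to the preceding stage `l`: it is there that `X j` arises as
    -- `X l * Y j`, so that `golden-power` bounds `X j` in terms of `Y j`.
    power : (2 ℕ.* Q ℕ.* X j) ℕ.^ l ℕ.≤ Q ℕ.^ a l
    power = bad-approximation {2 ℕ.+ f l} {l} {C} {X j} {Y j} {Q} (proj₁ (proj₂ (golden-split l (s≤s z≤n))))
      (golden-power {2 ℕ.+ f l} {l} {C} {X j} {X l} {Y j} {{_}} {{X≢0 j}}
        (proj₁ (proj₂ (golden-split l (s≤s z≤n)))) (proj₂ (proj₂ (golden-split l (s≤s z≤n)))) refl
        (ℕ.*-cancelˡ-≤ (X l) {{X≢0 l}} (X-lower l)))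
      Y≤4Q
      (ℕ.≤-trans (ℕ.≤-reflexive (ℕ.^-*-assoc 2 2 (a l))) (ℕ.≤-trans (X-large k (2 ℕ.* a l) size) (ℕ.<⇒≤ (X<Y l))))
      where
      size : 2 ℕ.* a l ℕ.≤ M ℕ.* ((k ℕ.+ 2) ℕ.* (k ℕ.+ 3))
      size = ℕ.≤-trans (ℕ.*-monoʳ-≤ 2 (a≤M l)) (ℕ.≤-trans (ℕ.≤-reflexive (eq M k))
        (ℕ.*-monoʳ-≤ M (ℕ.*-monoʳ-≤ (k ℕ.+ 2) (ℕ.≤-trans (s≤s (s≤s z≤n)) (ℕ.m≤n+m 3 k)))))
        where
        eq : ∀ m k → 2 ℕ.* (m ℕ.* suc (suc k)) ≡ m ℕ.* ((k ℕ.+ 2) ℕ.* 2)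
        eq = ℕ-Solver.solve-∀
    q x τ : ℚ
    q = fromℕ Q
    x = fromℕ (X j)
    τ = tail j
    0≤qx : 0ℚ ≤ q * x
    0≤qx = 0≤* (0≤fromℕ Q) (0≤fromℕ (X j))
    4QXτ≤1 : 4ℚ * q * x * τ ≤ 1ℚ
    4QXτ≤1 = begin
      4ℚ * q * x * τ               ≡⟨ cong (_* τ) (trans (fromℕ-* (4 ℕ.* Q) (X j)) (cong (_* x) (fromℕ-* 4 Q))) ⟨
      fromℕ (4 ℕ.* Q ℕ.* X j) * τ  ≤⟨ *-monoˡ τ (<⇒≤ (0<tail j)) (fromℕ-mono-≤ {4 ℕ.* Q ℕ.* X j} {X (suc j)}
                                        (ℕ.≤-trans (ℕ.≤-reflexive (ℕ.*-comm (4 ℕ.* Q) (X j))) (ℕ.*-monoʳ-≤ (X j) (ℕ.<⇒≤ 4Q<Y)))) ⟩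
      fromℕ (X (suc j)) * τ        ≡⟨ *-comm (fromℕ (X (suc j))) τ ⟩
      τ * fromℕ (X (suc j))        ≡⟨ tail-* j ⟩
      1ℚ                           ∎
      where open ≤-Reasoning
    gap : ∀ n → j ℕ.≤ n → 1ℚ ≤ (τ + τ + ∣ S n - r ∣) * (q * x)
    gap n j≤n = begin
      1ℚ                                          ≤⟨ 1≤∣r-s∣*↧ₙ {r} {S j} r≢S ⟩
      ∣ r - S j ∣ * (q * fromℕ (↧ₙ (S j)))        ≡⟨ cong (λ d → ∣ r - S j ∣ * (q * fromℕ d)) (↧ₙ-S j) ⟩
      ∣ r - S j ∣ * (q * x)                       ≡⟨ cong (λ p → ∣ p ∣ * (q * x)) (eq r (S j) (S n)) ⟩
      ∣ (S n - S j) - (S n - r) ∣ * (q * x)       ≤⟨ *-monoˡ (q * x) 0≤qx (≤-trans (∣p-q∣≤∣p∣+∣q∣ (S n - S j) (S n - r))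
                                                       (+-monoˡ-≤ ∣ S n - r ∣ (S-close j≤n ℕ.≤-refl))) ⟩
      (τ + τ + ∣ S n - r ∣) * (q * x)             ∎
      where
      open ≤-Reasoning
      eq : ∀ r s t → r - s ≡ (t - s) - (t - r)
      eq = solve-∀ ℚ-ring
    2QX : fromℕ (2 ℕ.* Q ℕ.* X j) ≡ 2ℚ * q * x
    2QX = trans (fromℕ-* (2 ℕ.* Q) (X j)) (cong (_* x) (fromℕ-* 2 Q))
    combine : ∀ D τ q x → ((τ + τ + D) * (q * x) - 1ℚ) + ((τ + τ + D) * (q * x) - 1ℚ) + (1ℚ - 4ℚ * q * x * τ)
      ≡ D * (2ℚ * q * x) - 1ℚ
    combine = solve-∀ ℚ-ring

  repelled : ∀ k r → Y (suc (suc k)) ℕ.≤ 4 ℕ.* ↧ₙ r → Repelled (suc k) r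
  repelled k r Y≤4Q =
    -- 4Q steps suffice to pass 4Q, because `Y (suc n)` exceeds `X n`, which is at least `n`.
    let l , k≤l , lo , hi = bracket (λ n → Y (suc n)) (4 ℕ.* ↧ₙ r) (4 ℕ.* ↧ₙ r) (suc k) Y≤4Q
          (ℕ.≤-<-trans (ℕ.≤-trans (ℕ.m≤m+n (4 ℕ.* ↧ₙ r) (suc k)) (n≤X (4 ℕ.* ↧ₙ r ℕ.+ suc k))) (X<Y (4 ℕ.* ↧ₙ r ℕ.+ suc k)))
    in cases l k≤l lo hi (r ≟ S (suc l))
    where
    cases : ∀ l → suc k ℕ.≤ l → Y (suc l) ℕ.≤ 4 ℕ.* ↧ₙ r → 4 ℕ.* ↧ₙ r ℕ.< Y (suc (suc l)) →
      Dec (r ≡ S (suc l)) → Repelled (suc k) r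
    cases l       k<l lo hi (yes r≡S) = partial-sum-repelled (suc l) (ℕ.≤-trans k<l (ℕ.n≤1+n l)) r≡S
    cases (suc l) k<l lo hi (no r≢S)  = other-repelled l k<l lo hi r≢S

  number-≥ : ∀ n → fromℕ i ≤ seq number n
  number-≥ n = subst (_≤ S n) (trans (+-identityʳ (integer i)) (integer≡fromℕ i)) (S-mono {0} {n} z≤n)

  S-≤ : ∀ n → S n ≤ fromℕ i + 2ℚ
  S-≤ n = ≤-trans (S-upper {0} {n} z≤n) (+-mono-≤
    (≤-reflexive (trans (+-identityʳ (integer i)) (integer≡fromℕ i))) (+-mono-≤ tail≤1 tail≤1))
    where
    tail≤1 : tail 0 ≤ 1ℚ
    tail≤1 = begin
      tail 0                ≡⟨ *-identityʳ (tail 0) ⟨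
      tail 0 * 1ℚ           ≤⟨ *-monoʳ (tail 0) (<⇒≤ (0<tail 0)) (fromℕ-mono-≤ {1} {X 1} (0<X 1)) ⟩
      tail 0 * fromℕ (X 1)  ≡⟨ tail-* 0 ⟩
      1ℚ                    ∎
      where open ≤-Reasoning

  module _ {μ : ℝ} (ν<μ : ν <ᴿ μ) where

    private
      ε₁ : ℚ
      ε₁ = proj₁ ν<μ
      k J D : ℕ
      -- At least 4/ε₁, so for l ≥ J the excess of `a l` over l ν, at most 4, is covered by l ε₁.
      k = 4 ℕ.* ↧ₙ ε₁
      J = suc k
      D = Y (suc J)

    a/J≤ : ∀ {ρ} → μ <ᴿ fromℚ ρ → ∀ l → J ℕ.≤ l → fromℕ (a l) ≤ fromℕ l * ρ
    a/J≤ {ρ} (ε₃ , 0<ε₃ , μ<ρ) l J≤l = proj₂ (sometime ((λ {n} above below le → 0≤q-p⇒p≤q (subst (0ℚ ≤_)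
      (trans (eq (fromℕ l) (fromℕ (f l)) (seq ν n) (seq μ n) ρ ε₁ ε₃) (cong (λ t → fromℕ l * ρ - t) (sym (fromℕ-a l))))
      (0≤+ (0≤+ (0≤+ (0≤* (0≤fromℕ l) (p≤q⇒0≤q-p le)) (0≤* (0≤fromℕ l) (<⇒≤ 0<ε₃)))
        (0≤* (0≤fromℕ l) (p≤q⇒0≤q-p below))) (0≤+ (p≤q⇒0≤q-p 4≤lε₁) (p≤q⇒0≤q-p above)))))
      <$> f-upper l <*> proj₂ (proj₂ ν<μ) <*> μ<ρ))
      where
      eq : ∀ l f v m ρ ε₁ ε₃ → l * (ρ - (m + ε₃)) + l * ε₃ + l * (m - (v + ε₁)) + ((ε₁ * l - 4ℚ) + (l * v + 1ℚ - f))
        ≡ l * ρ - (3ℚ + f)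
      eq = solve-∀ ℚ-ring
      0≤ε₁ : 0ℚ ≤ ε₁
      0≤ε₁ = <⇒≤ (proj₁ (proj₂ ν<μ))
      4≤lε₁ : 4ℚ ≤ ε₁ * fromℕ l
      4≤lε₁ = begin
        4ℚ * 1ℚ                      ≤⟨ *-monoʳ 4ℚ (from-yes (0ℚ ≤? 4ℚ)) (archimedean (proj₁ (proj₂ ν<μ))) ⟩
        4ℚ * (ε₁ * fromℕ (↧ₙ ε₁))    ≡⟨ swap 4ℚ ε₁ (fromℕ (↧ₙ ε₁)) ⟩
        ε₁ * (4ℚ * fromℕ (↧ₙ ε₁))    ≡⟨ cong (λ t → ε₁ * t) (fromℕ-* 4 (↧ₙ ε₁)) ⟨
        ε₁ * fromℕ k                 ≤⟨ *-monoʳ ε₁ 0≤ε₁ (fromℕ-mono-≤ {k} {l} (ℕ.≤-trans (ℕ.n≤1+n k) J≤l)) ⟩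
        ε₁ * fromℕ l                 ∎
        where
        open ≤-Reasoning
        swap : ∀ a b c → a * (b * c) ≡ b * (a * c)
        swap = solve-∀ ℚ-ring

    -- α lies between i and i + 2, and a good approximation is within 1 of it, hence between 0 and i
    -- + 3 as i ≥ 1. With denominators up to `D`, numerators up to `(i + 3) * D` suffice.
    candidates : List ℚ
    candidates = fractions ((i ℕ.+ 3) ℕ.* D) D

    module _ {r t ρ : ℚ} (0<t : 0ℚ < t) (μ<ρ : μ <ᴿ fromℚ ρ)
      (small : t ^ ↧ₙ ρ * fromℕ (↧ₙ r) ^ᶻ ↥ ρ < 1ℚ)
      (near : Eventually (λ n → ∣ S n - r ∣ ≤ t)) where

      0≤ρ : 0ℚ ≤ ρ
      0≤ρ = *-cancelʳ 0ℚ ρ (fromℕ-mono-< {0} {J} (s≤s z≤n)) (begin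
        0ℚ * fromℕ J    ≡⟨ *-zeroˡ (fromℕ J) ⟩
        0ℚ              ≤⟨ 0≤fromℕ (a J) ⟩
        fromℕ (a J)     ≤⟨ a/J≤ {ρ} μ<ρ J ℕ.≤-refl ⟩
        fromℕ J * ρ     ≡⟨ *-comm (fromℕ J) ρ ⟩
        ρ * fromℕ J     ∎)
        where open ≤-Reasoning

      0<Q : 0 ℕ.< ↧ₙ r
      0<Q = s≤s z≤n

      t-small : ∀ l z → J ℕ.≤ l → z ℕ.^ l ℕ.≤ ↧ₙ r ℕ.^ a l → ¬ (1ℚ ≤ t * fromℕ z)
      t-small l z J≤l zˡ≤Qᵃ 1≤tz = <⇒≱ small (subst (λ p → 1ℚ ≤ t ^ ↧ₙ ρ * p)
        (sym (^ᶻ-nonNeg (fromℕ (↧ₙ r)) 0≤ρ))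
        (1≤t^b*Q^c {t} {z} {↧ₙ r} {a l} {l} {↧ₙ ρ} {ℤ.∣ ↥ ρ ∣} (<⇒≤ 0<t) (ℕ.≤-trans (s≤s z≤n) J≤l) 0<Q 1≤tz zˡ≤Qᵃ
          (≥-cross {ρ} l (a l) 0≤ρ (a/J≤ {ρ} μ<ρ l J≤l))))

      t<1 : t < 1ℚ
      -- The choice z = 1 satisfies the power condition trivially.
      t<1 = ≰⇒> λ 1≤t → t-small J 1 ℕ.≤-refl
        (ℕ.≤-trans (ℕ.≤-reflexive (ℕ.^-zeroˡ J)) (ℕ.m^n>0 (↧ₙ r) (a J)))
        (subst (1ℚ ≤_) (sym (*-identityʳ t)) 1≤t)

      not-large : ¬ (D ℕ.≤ 4 ℕ.* ↧ₙ r)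
      not-large le =
        let l , z , J≤l , zˡ≤Qᵃ , away = repelled k r le
        in t-small l z J≤l zˡ≤Qᵃ (proj₂ (sometime
             ((λ {n} h close → ≤-trans h (*-monoˡ (fromℕ z) (0≤fromℕ z) close)) <$> away <*> near)))

      ∈-candidates : r ∈ candidates
      ∈-candidates = ∈-fractions {r} {(i ℕ.+ 3) ℕ.* D} {D} (proj₂ (sometime ((λ {n} → 0≤r {n}) <$> near))) num≤ Q≤D
        where
        Q≤D : ↧ₙ r ℕ.≤ D
        Q≤D = ℕ.≤-trans (ℕ.m≤m+n (↧ₙ r) (3 ℕ.* ↧ₙ r)) (ℕ.<⇒≤ (ℕ.≰⇒> not-large))
        eq : ∀ s r t i → (s - i) + (t - (s - r)) + (1ℚ - t) + (i - 1ℚ) ≡ r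
        eq = solve-∀ ℚ-ring
        0≤r : ∀ {n} → ∣ S n - r ∣ ≤ t → 0ℚ ≤ r
        0≤r {n} close = subst (0ℚ ≤_) (eq (S n) r t (fromℕ i)) (0≤+ (0≤+ (0≤+ (p≤q⇒0≤q-p (number-≥ n))
          (p≤q⇒0≤q-p (≤-trans (p≤∣p∣ (S n - r)) close))) (p≤q⇒0≤q-p (<⇒≤ t<1)))
          (p≤q⇒0≤q-p (fromℕ-mono-≤ {1} {i} 0<i)))
        eq₂ : ∀ s r t i → (i + 2ℚ - s) + (t - (r - s)) + (1ℚ - t) ≡ i + 3ℚ - r
        eq₂ = solve-∀ ℚ-ring
        r≤i+3 : r ≤ fromℕ (i ℕ.+ 3)
        r≤i+3 = proj₂ (sometime ((λ {n} close → 0≤q-p⇒p≤q (subst (0ℚ ≤_)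
          (trans (eq₂ (S n) r t (fromℕ i)) (cong (_- r) (sym (fromℕ-+ i 3))))
          (0≤+ (0≤+ (p≤q⇒0≤q-p (S-≤ n)) (p≤q⇒0≤q-p (≤-trans (p≤∣p∣ (r - S n)) (≤-trans (≤-reflexive (∣∣-sym r (S n))) close))))
            (p≤q⇒0≤q-p (<⇒≤ t<1))))) <$> near))
        num≤ : r * fromℕ (↧ₙ r) ≤ fromℕ ((i ℕ.+ 3) ℕ.* D)
        num≤ = ≤-trans (*-mono (0≤fromℕ (i ℕ.+ 3)) (0≤fromℕ (↧ₙ r)) r≤i+3 (fromℕ-mono-≤ {↧ₙ r} {D} Q≤D))
          (≤-reflexive (sym (fromℕ-* (i ℕ.+ 3) D)))

    -- Every fraction that approximates with exponent μ has a denominator too small to be repelled,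
    -- so it belongs to the finite list `candidates`; a fraction avoiding that list is
    -- contradictory.
    not-approximable : ¬ Approximable α μ
    not-approximable approximable =
      let r , (_ , t , (0<t , ρ , μ<ρ , small) , ε , 0<ε , close) , r∉ = approximable candidates
      in All.lookup r∉ (∈-candidates {r} {t} {ρ} 0<t μ<ρ small
           ((λ {n} h → ≤-trans (subst (_≤ ∣ S n - r ∣ + ε) (+-identityʳ ∣ S n - r ∣) (+-monoʳ-≤ ∣ S n - r ∣ (<⇒≤ 0<ε))) h) <$> close))
           refl

  -- A term `v` of ν within δ = ε/4 yields `s`, which lies between ν - 3δ and ν - δ. Subtracting
  -- another δ/2 for μ still leaves δ/2 above `l`.
  interpolate : ∀ {l} → l <ᴿ ν → ∃ λ μ → ∃ λ r → l <ᴿ μ × μ <ᴿ fromℚ r × 0ℚ ≤ r × fromℚ r <ᴿ ν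
  interpolate {l} (ε , 0<ε , l<ν) =
    let r , s≤r , 0≤r , r<ν = choose (≤-total s ½)
    in fromℚ (r - ½ * δ) , r
     , (½ * δ , 0<½* 0<δ , ((λ {n} le h → 0≤q-p⇒p≤q (subst (0ℚ ≤_) (eq₁ (seq l n) (seq ν n) v δ r ε)
          (0≤+ (0≤+ (p≤q⇒0≤q-p le) (p≤q⇒0≤q-p s≤r)) (p≤q⇒0≤q-p (upper h))))) <$> l<ν <*> close))
     , (½ * δ , 0<½* 0<δ , 0 , λ _ _ → ≤-reflexive (eq₂ r δ))
     , 0≤r , r<ν
    where
    δ : ℚ
    δ = ¼ * ε
    0<δ : 0ℚ < δ
    0<δ = 0<* (from-yes (0ℚ <? ¼)) 0<ε
    N : ℕ
    N = proj₁ (cauchy ν δ 0<δ)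
    v s : ℚ
    v = seq ν N
    s = v - 2ℚ * δ
    close : Eventually (λ n → ∣ seq ν n - v ∣ ≤ δ)
    close = N , λ n le → <⇒≤ (proj₂ (cauchy ν δ 0<δ) n N le ℕ.≤-refl)
    upper : ∀ {n} → ∣ seq ν n - v ∣ ≤ δ → seq ν n - v ≤ δ
    upper {n} = ≤-trans (p≤∣p∣ (seq ν n - v))
    lower : ∀ {n} → ∣ seq ν n - v ∣ ≤ δ → v - seq ν n ≤ δ
    lower {n} h = ≤-trans (p≤∣p∣ (v - seq ν n)) (≤-trans (≤-reflexive (∣∣-sym v (seq ν n))) h)
    eq₁ : ∀ l ν v δ r ε → (ν - (l + ε)) + (r - (v - 2ℚ * (¼ * ε))) + ((¼ * ε) - (ν - v)) ≡ (r - ½ * (¼ * ε)) - (l + ½ * (¼ * ε))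
    eq₁ = solve-∀ ℚ-ring
    eq₂ : ∀ r δ → r - ½ * δ + ½ * δ ≡ r
    eq₂ = solve-∀ ℚ-ring
    eq₃ : ∀ ν v δ → δ - (v - ν) ≡ ν - (v - 2ℚ * δ + δ)
    eq₃ = solve-∀ ℚ-ring
    choose : s ≤ ½ ⊎ ½ ≤ s → ∃ λ r → s ≤ r × 0ℚ ≤ r × fromℚ r <ᴿ ν
    -- `l` may be negative, so `s` may be too; 1/2 then replaces it and is below ν because ν is at
    -- least 1.
    choose (inj₁ s≤½) = ½ , s≤½ , from-yes (0ℚ ≤? ½) , ½ , from-yes (0ℚ <? ½) , 1≤ν
    choose (inj₂ ½≤s) = s , ≤-refl , ≤-trans (from-yes (0ℚ ≤? ½)) ½≤s , δ , 0<δ ,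
      ((λ {n} h → 0≤q-p⇒p≤q (subst (0ℚ ≤_) (eq₃ (seq ν n) v δ) (p≤q⇒0≤q-p (lower h)))) <$> close)

  irrationalityExponent : IrrationalityExponent number ν
  irrationalityExponent =
      (λ μ approximable ν<μ → not-approximable {μ} ν<μ approximable)
    , λ l l<ν →
        let μ , r , l<μ , μ<r , 0≤r , r<ν = interpolate {l} l<ν
        in μ , approximable {r} 0≤r r<ν {μ} μ<r , l<μ

-- Moving α past finitely many given reals.

strict-bound : List ℝ → ℕ
strict-bound []       = 1
-- The successor provides the gap of 1 that witnesses apartness from `x`.
strict-bound (x ∷ xs) = suc (bound x) ℕ.⊔ strict-bound xs

theorem3p4 : ∀ (ν : ℝ) → ⟨3+√5⟩/2 ≤ᴿ ν →
    InfinitelyMany _#_ λ α → ModifiedEngelOrPierce α × IrrationalityExponent α ν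
theorem3p4 ν φ²≤ν xs = number , (inj₁ modifiedEngel , irrationalityExponent) , apart xs ℕ.≤-refl
  where
  open AboveGolden ν φ²≤ν using (module Approximation)
  open Approximation using (f; f-lower; f-upper)
  1≤strict-bound : ∀ xs → 1 ℕ.≤ strict-bound xs
  1≤strict-bound []       = ℕ.≤-refl
  1≤strict-bound (x ∷ xs) = ℕ.≤-trans (s≤s z≤n) (ℕ.m≤m⊔n (suc (bound x)) (strict-bound xs))
  open Number ν φ²≤ν f f-lower f-upper (strict-bound xs) (1≤strict-bound xs)
  apart : ∀ ys → strict-bound ys ℕ.≤ strict-bound xs → All (number #_) ys
  apart []       _  = []
  apart (y ∷ ys) le =
      inj₂ (1ℚ , 0<1 , ((λ {n} y≤ → ≤-trans (≤-trans (+-monoˡ-≤ 1ℚ y≤)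
        (≤-trans (≤-reflexive (trans (+-comm (fromℕ (bound y)) 1ℚ) (sym (fromℕ-+ 1 (bound y)))))
          (fromℕ-mono-≤ {suc (bound y)} {strict-bound xs} (ℕ.m⊔n≤o⇒m≤o (suc (bound y)) (strict-bound ys) le)))) (number-≥ n))
        <$> ≤bound y))
    ∷ apart ys (ℕ.m⊔n≤o⇒n≤o (suc (bound y)) (strict-bound ys) le)
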